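{- For all positive integers $m$ and $k$, $$\begin{aligned} \zeta\left(\bar1,\{1\}_{m-1},2,\{1\}_{k-1}\right)=&\ (-1)^m\binom{m+k}{k}\,\zeta\left(\bar2,\{1\}_{m+k-1}\right)-\frac{(\ln2)^m}{m!}\,\zeta\left(\bar2,\{1\}_{k-1}\right)\\ &-\sum_{i=1}^{m-1}\frac{(\ln2)^i}{i!}\,\zeta\left(\bar1,\{1\}_{m-i-1},2,\{1\}_{k-1}\right). \end{aligned}$$
   Context: Notation. $\{1\}_r$ denotes the string of $r$ entries equal to $1$ (empty if $r=0$). For positive integers $s_1,\dots,s_r$, $\zeta(s_1,\dots,s_r):=\lim_{n\to\infty}\sum_{n\ge k_1>\cdots>k_r\ge1}\frac{1}{k_1^{s_1}\cdots k_r^{s_r}}$. A bar over an entry $s_j$ means that the factor $(-1)^{k_j}$ is inserted in the summand; e.g. $\zeta(\bar1,\{1\}_{m-1},2,\{1\}_{k-1})=\lim_{n\to\infty}\sum_{n\ge k_1>\cdots>k_{m+k}\ge1}\frac{(-1)^{k_1}}{k_1\cdots k_m\,k_{m+1}^2\,k_{m+2}\cdots k_{m+k}}$. Sums over empty ranges are $0$. -}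

module Defs where

open import Data.Empty using (⊥; ⊥-elim)
open import Data.Integer.Base as ℤ using (+[1+_])
import Data.Integer.Properties as ℤ
open import Data.List.Base using (List; []; _∷_; length; replicate)
open import Data.Maybe.Base using (Maybe; just; nothing)
open import Data.Nat.Base as ℕ using (ℕ; zero; suc; z≤n; s≤s; _!)
import Data.Nat.Properties as ℕ
open import Data.Product.Base using (∃; _×_; _,_; proj₁; proj₂)
open import Data.Rational.Base
open import Data.Rational.Properties
import Data.Rational.Unnormalised.Base as ℚᵘ
import Data.Rational.Unnormalised.Properties as ℚᵘ
open import Data.Sum.Base using (inj₁; inj₂)
open import Data.Unit.Base using (⊤)
open import Level using (0ℓ)
open import Relation.Binary.PropositionalEquality
open import Relation.Nullary.Decidable.Core using (True; toWitness; yes; no)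
open import Tactic.RingSolver using (solve-∀)
open import Tactic.RingSolver.Core.AlmostCommutativeRing
  using (AlmostCommutativeRing; fromCommutativeRing)

fromℕ : ℕ → ℚ
fromℕ n = ℤ.+ n / 1

module RationalLemmas where

  isZero : ∀ x → Maybe (0ℚ ≡ x)
  isZero x with 0ℚ ≟ x
  ... | yes p = just p
  ... | no  _ = nothing

  ℚ-ring : AlmostCommutativeRing 0ℓ 0ℓ
  ℚ-ring = fromCommutativeRing +-*-commutativeRing isZero

  *-mono-≤ : ∀ {a b c d} → 0ℚ ≤ a → a ≤ b → 0ℚ ≤ c → c ≤ d → a * c ≤ b * d
  *-mono-≤ {a} {b} {c} {d} 0≤a a≤b 0≤c c≤d = ≤-trans
    (*-monoˡ-≤-nonNeg a {{nonNegative 0≤a}} c≤d)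
    (*-monoʳ-≤-nonNeg d {{nonNegative (≤-trans 0≤c c≤d)}} a≤b)

  *-nonneg : ∀ {a b} → 0ℚ ≤ a → 0ℚ ≤ b → 0ℚ ≤ a * b
  *-nonneg {a} {b} 0≤a 0≤b =
    subst (_≤ a * b) (*-zeroˡ 0ℚ) (*-mono-≤ ≤-refl 0≤a ≤-refl 0≤b)

  +-nonneg : ∀ {a b} → 0ℚ ≤ a → 0ℚ ≤ b → 0ℚ ≤ a + b
  +-nonneg {a} {b} 0≤a 0≤b = subst (_≤ a + b) (+-identityʳ 0ℚ) (+-mono-≤ 0≤a 0≤b)

  *-pos : ∀ {a b} → 0ℚ < a → 0ℚ < b → 0ℚ < a * b
  *-pos {a} {b} 0<a 0<b =
    positive⁻¹ (a * b) {{pos*pos⇒pos a {{positive 0<a}} b {{positive 0<b}}}}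

  +-nonneg-pos : ∀ {a b} → 0ℚ ≤ a → 0ℚ < b → 0ℚ < a + b
  +-nonneg-pos {a} {b} 0≤a 0<b = subst (_< a + b) (+-identityʳ 0ℚ) (+-mono-≤-< 0≤a 0<b)

  0<1 : 0ℚ < 1ℚ
  0<1 = positive⁻¹ 1ℚ

  0<½ : 0ℚ < ½
  0<½ = positive⁻¹ ½

  ½+½ : ∀ e → ½ * e + ½ * e ≡ e
  ½+½ = solve-∀ ℚ-ring

  half-pos : ∀ {e} → 0ℚ < e → 0ℚ < ½ * e
  half-pos = *-pos 0<½

  half-< : ∀ {e} → 0ℚ < e → ½ * e < e
  half-< {e} 0<e = subst₂ _<_ (+-identityʳ (½ * e)) (½+½ e) (+-monoʳ-< (½ * e) (half-pos 0<e))

  a≤a+b : ∀ {a b} → 0ℚ ≤ b → a ≤ a + b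
  a≤a+b {a} {b} 0≤b = subst (_≤ a + b) (+-identityʳ a) (+-monoʳ-≤ a 0≤b)

  b≤a+b : ∀ {a b} → 0ℚ ≤ a → b ≤ a + b
  b≤a+b {a} {b} 0≤a = subst (_≤ a + b) (+-identityˡ b) (+-monoˡ-≤ b 0≤a)

  ≤⇒0≤- : ∀ {a b} → a ≤ b → 0ℚ ≤ b - a
  ≤⇒0≤- {a} {b} a≤b = subst (_≤ b - a) (+-inverseʳ a) (+-monoˡ-≤ (- a) a≤b)

  0≤-⇒≤ : ∀ {a b} → 0ℚ ≤ b - a → a ≤ b
  0≤-⇒≤ {a} {b} p = subst₂ _≤_ (+-identityˡ a) (eq a b) (+-monoˡ-≤ a p)
    where
    eq : ∀ a b → b - a + a ≡ b
    eq = solve-∀ ℚ-ring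

  -- A fraction δ of ε small enough that multiplication by K keeps it below ε.
  shrink : ∀ e K → 0ℚ < e → 0ℚ < K → ∃ λ d → 0ℚ < d × d * K ≡ ½ * e
  shrink e K 0<e 0<K = ½ * e * K⁻¹ , *-pos (half-pos 0<e) 0<K⁻¹ , eq
    where
    instance
      K-pos : Positive K
      K-pos = positive 0<K
      K-nz : NonZero K
      K-nz = pos⇒nonZero K
    K⁻¹ : ℚ
    K⁻¹ = 1/ K
    0<K⁻¹ : 0ℚ < K⁻¹
    0<K⁻¹ = positive⁻¹ K⁻¹ {{1/pos⇒pos K}}
    eq : ½ * e * K⁻¹ * K ≡ ½ * e
    eq = trans (*-assoc (½ * e) K⁻¹ K)
         (trans (cong (½ * e *_) (*-inverseˡ K)) (*-identityʳ (½ * e)))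

  x≤∣x∣ : ∀ x → x ≤ ∣ x ∣
  x≤∣x∣ x with ≤-total 0ℚ x
  ... | inj₁ 0≤x = ≤-reflexive (sym (0≤p⇒∣p∣≡p 0≤x))
  ... | inj₂ x≤0 = ≤-trans x≤0 (0≤∣p∣ x)

  -x≤∣x∣ : ∀ x → - x ≤ ∣ x ∣
  -x≤∣x∣ x = subst (- x ≤_) (∣-p∣≡∣p∣ x) (x≤∣x∣ (- x))

  ∣∣-elim : ∀ (P : ℚ → Set) {x} → P x → P (- x) → P ∣ x ∣
  ∣∣-elim P {x} p q with ∣p∣≡p∨∣p∣≡-p x
  ... | inj₁ eq = subst P (sym eq) p
  ... | inj₂ eq = subst P (sym eq) q

  neg-- : ∀ x y → - (x - y) ≡ y - x
  neg-- = solve-∀ ℚ-ring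

  ∣-∣-sym : ∀ x y → ∣ x - y ∣ ≡ ∣ y - x ∣
  ∣-∣-sym x y = trans (sym (∣-p∣≡∣p∣ (x - y))) (cong ∣_∣ (neg-- x y))

  triangle : ∀ x y z → ∣ x - z ∣ ≤ ∣ x - y ∣ + ∣ y - z ∣
  triangle x y z =
    subst (_≤ ∣ x - y ∣ + ∣ y - z ∣) (cong ∣_∣ (eq x y z)) (∣p+q∣≤∣p∣+∣q∣ (x - y) (y - z))
    where
    eq : ∀ x y z → (x - y) + (y - z) ≡ x - z
    eq = solve-∀ ℚ-ring

open RationalLemmas

IsNull : (ℕ → ℚ) → Set
IsNull x = ∀ ε → 0ℚ < ε → ∃ λ N → ∀ n → N ℕ.≤ n → ∣ x n ∣ < ε

IsCauchy : (ℕ → ℚ) → Set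
IsCauchy x = ∀ ε → 0ℚ < ε → ∃ λ N → ∀ m n → N ℕ.≤ m → N ℕ.≤ n → ∣ x m - x n ∣ < ε

-- A real number is a Cauchy sequence of rationals, up to _≃ᵣ_; the sequence
-- converges to the real it represents, so lim x _ is the limit of x.
record ℝ : Set where
  constructor lim
  field
    approx : ℕ → ℚ
    cauchy : IsCauchy approx

open ℝ public

infix 4 _≃ᵣ_

_≃ᵣ_ : ℝ → ℝ → Set
x ≃ᵣ y = IsNull (λ n → approx x n - approx y n)

module CauchyLemmas where

  const-cauchy : ∀ q → IsCauchy (λ _ → q)
  const-cauchy q ε 0<ε = 0 , λ _ _ _ _ → subst (_< ε) (cong ∣_∣ (sym (+-inverseʳ q))) 0<ε

  cauchy-cong : ∀ x y → (∀ n → x n ≡ y n) → IsCauchy x → IsCauchy y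
  cauchy-cong x y x≡y cx ε 0<ε with cx ε 0<ε
  ... | N , f = N , λ m n N≤m N≤n →
    subst₂ (λ a b → ∣ a - b ∣ < ε) (x≡y m) (x≡y n) (f m n N≤m N≤n)

  null-+ : ∀ x y → IsNull x → IsNull y → IsNull (λ n → x n + y n)
  null-+ x y nx ny ε 0<ε with nx (½ * ε) (half-pos 0<ε) | ny (½ * ε) (half-pos 0<ε)
  ... | M , f | N , g = M ℕ.⊔ N , λ n le → begin-strict
    ∣ x n + y n ∣      ≤⟨ ∣p+q∣≤∣p∣+∣q∣ (x n) (y n) ⟩
    ∣ x n ∣ + ∣ y n ∣  <⟨ +-mono-< (f n (ℕ.m⊔n≤o⇒m≤o M N le)) (g n (ℕ.m⊔n≤o⇒n≤o M N le)) ⟩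
    ½ * ε + ½ * ε      ≡⟨ ½+½ ε ⟩
    ε                  ∎
    where open ≤-Reasoning

  null-≤ : ∀ x y → (∀ n → ∣ x n ∣ ≤ ∣ y n ∣) → IsNull y → IsNull x
  null-≤ x y x≤y ny ε 0<ε with ny ε 0<ε
  ... | N , f = N , λ n N≤n → ≤-<-trans (x≤y n) (f n N≤n)

  null-scale : ∀ c x → IsNull x → IsNull (λ n → c * x n)
  null-scale c x nx ε 0<ε with shrink ε (∣ c ∣ + 1ℚ) 0<ε (+-nonneg-pos (0≤∣p∣ c) 0<1)
  ... | d , 0<d , dK with nx d 0<d
  ... | N , f = N , λ n N≤n → begin-strict
    ∣ c * x n ∣           ≡⟨ ∣p*q∣≡∣p∣*∣q∣ c (x n) ⟩
    ∣ c ∣ * ∣ x n ∣       ≤⟨ *-mono-≤ (0≤∣p∣ c) (a≤a+b (<⇒≤ 0<1)) (0≤∣p∣ (x n)) (<⇒≤ (f n N≤n)) ⟩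
    (∣ c ∣ + 1ℚ) * d      ≡⟨ *-comm (∣ c ∣ + 1ℚ) d ⟩
    d * (∣ c ∣ + 1ℚ)      ≡⟨ dK ⟩
    ½ * ε                 <⟨ half-< 0<ε ⟩
    ε                     ∎
    where open ≤-Reasoning

  null⇒cauchy : ∀ x → IsNull x → IsCauchy x
  null⇒cauchy x nx ε 0<ε with nx (½ * ε) (half-pos 0<ε)
  ... | N , f = N , λ m n N≤m N≤n → begin-strict
    ∣ x m - x n ∣      ≤⟨ ∣p-q∣≤∣p∣+∣q∣ (x m) (x n) ⟩
    ∣ x m ∣ + ∣ x n ∣  <⟨ +-mono-< (f m N≤m) (f n N≤n) ⟩
    ½ * ε + ½ * ε      ≡⟨ ½+½ ε ⟩
    ε                  ∎
    where open ≤-Reasoning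

  cauchy-+ : ∀ x y → IsCauchy x → IsCauchy y → IsCauchy (λ n → x n + y n)
  cauchy-+ x y cx cy ε 0<ε with cx (½ * ε) (half-pos 0<ε) | cy (½ * ε) (half-pos 0<ε)
  ... | M , f | N , g = M ℕ.⊔ N , λ m n lm ln → begin-strict
    ∣ (x m + y m) - (x n + y n) ∣      ≡⟨ cong ∣_∣ (eq (x m) (y m) (x n) (y n)) ⟩
    ∣ (x m - x n) + (y m - y n) ∣      ≤⟨ ∣p+q∣≤∣p∣+∣q∣ (x m - x n) (y m - y n) ⟩
    ∣ x m - x n ∣ + ∣ y m - y n ∣      <⟨ +-mono-< (f m n (ℕ.m⊔n≤o⇒m≤o M N lm) (ℕ.m⊔n≤o⇒m≤o M N ln))
                                                   (g m n (ℕ.m⊔n≤o⇒n≤o M N lm) (ℕ.m⊔n≤o⇒n≤o M N ln)) ⟩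
    ½ * ε + ½ * ε                      ≡⟨ ½+½ ε ⟩
    ε                                  ∎
    where
    open ≤-Reasoning
    eq : ∀ a b c d → (a + b) - (c + d) ≡ (a - c) + (b - d)
    eq = solve-∀ ℚ-ring

  cauchy-neg : ∀ x → IsCauchy x → IsCauchy (λ n → - x n)
  cauchy-neg x cx ε 0<ε with cx ε 0<ε
  ... | N , f = N , λ m n N≤m N≤n →
    subst (_< ε) (trans (sym (∣-p∣≡∣p∣ (x m - x n))) (cong ∣_∣ (neg-distrib-+ (x m) (- x n))))
      (f m n N≤m N≤n)

  prefix : (ℕ → ℚ) → ℕ → ℚ
  prefix x zero    = 0ℚ
  prefix x (suc n) = prefix x n + ∣ x n ∣

  prefix≥0 : ∀ x n → 0ℚ ≤ prefix x n
  prefix≥0 x zero    = ≤-refl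
  prefix≥0 x (suc n) = +-nonneg (prefix≥0 x n) (0≤∣p∣ (x n))

  prefix-bound : ∀ x {n N} → n ℕ.<′ N → ∣ x n ∣ ≤ prefix x N
  prefix-bound x {n} ℕ.≤′-refl        = b≤a+b (prefix≥0 x n)
  prefix-bound x     (ℕ.≤′-step n<N) = ≤-trans (prefix-bound x n<N) (a≤a+b (0≤∣p∣ (x _)))

  bounded : ∀ x → IsCauchy x → ∃ λ B → 0ℚ < B × (∀ n → ∣ x n ∣ ≤ B)
  bounded x cx with cx 1ℚ 0<1
  ... | N , f = B , +-nonneg-pos (prefix≥0 x (suc N)) 0<1 , bound
    where
    B : ℚ
    B = prefix x (suc N) + 1ℚ
    bound : ∀ n → ∣ x n ∣ ≤ B
    bound n with ℕ.<-≤-connex n N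
    ... | inj₁ n<N = ≤-trans (prefix-bound x (ℕ.<⇒<′ (ℕ.m≤n⇒m≤1+n n<N))) (a≤a+b (<⇒≤ 0<1))
    ... | inj₂ N≤n = begin
      ∣ x n ∣                        ≡⟨ cong ∣_∣ (eq (x n) (x N)) ⟩
      ∣ x N + (x n - x N) ∣          ≤⟨ ∣p+q∣≤∣p∣+∣q∣ (x N) (x n - x N) ⟩
      ∣ x N ∣ + ∣ x n - x N ∣        ≤⟨ +-mono-≤ (b≤a+b (prefix≥0 x N)) (<⇒≤ (f n N N≤n ℕ.≤-refl)) ⟩
      B                              ∎
      where
      open ≤-Reasoning
      eq : ∀ a b → a ≡ b + (a - b)
      eq = solve-∀ ℚ-ring

  cauchy-* : ∀ x y → IsCauchy x → IsCauchy y → IsCauchy (λ n → x n * y n)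
  cauchy-* x y cx cy ε 0<ε with bounded x cx | bounded y cy
  ... | B , 0<B , xB | C , 0<C , yC with shrink ε (C + B) 0<ε (+-nonneg-pos (<⇒≤ 0<C) 0<B)
  ... | d , 0<d , dK with cx d 0<d | cy d 0<d
  ... | M , f | N , g = M ℕ.⊔ N , λ m n lm ln → begin-strict
    ∣ x m * y m - x n * y n ∣
      ≡⟨ cong ∣_∣ (eq (x m) (y m) (x n) (y n)) ⟩
    ∣ (x m - x n) * y m + x n * (y m - y n) ∣
      ≤⟨ ∣p+q∣≤∣p∣+∣q∣ ((x m - x n) * y m) (x n * (y m - y n)) ⟩
    ∣ (x m - x n) * y m ∣ + ∣ x n * (y m - y n) ∣
      ≡⟨ cong₂ _+_ (∣p*q∣≡∣p∣*∣q∣ (x m - x n) (y m)) (∣p*q∣≡∣p∣*∣q∣ (x n) (y m - y n)) ⟩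
    ∣ x m - x n ∣ * ∣ y m ∣ + ∣ x n ∣ * ∣ y m - y n ∣
      ≤⟨ +-mono-≤
           (*-mono-≤ (0≤∣p∣ (x m - x n)) (<⇒≤ (f m n (ℕ.m⊔n≤o⇒m≤o M N lm) (ℕ.m⊔n≤o⇒m≤o M N ln))) (0≤∣p∣ (y m)) (yC m))
           (*-mono-≤ (0≤∣p∣ (x n)) (xB n) (0≤∣p∣ (y m - y n)) (<⇒≤ (g m n (ℕ.m⊔n≤o⇒n≤o M N lm) (ℕ.m⊔n≤o⇒n≤o M N ln)))) ⟩
    d * C + B * d
      ≡⟨ eq′ d B C ⟩
    d * (C + B)
      ≡⟨ dK ⟩
    ½ * ε
      <⟨ half-< 0<ε ⟩
    ε ∎
    where
    open ≤-Reasoning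
    eq : ∀ a b c d → a * b - c * d ≡ (a - c) * b + c * (b - d)
    eq = solve-∀ ℚ-ring
    eq′ : ∀ d B C → d * C + B * d ≡ d * (C + B)
    eq′ = solve-∀ ℚ-ring

open CauchyLemmas

infixl 6 _+ᵣ_ _-ᵣ_
infixl 7 _*ᵣ_ _/!_
infix  8 -ᵣ_
infixr 9 _^ᵣ_

fromℚ : ℚ → ℝ
fromℚ q = lim (λ _ → q) (const-cauchy q)

_+ᵣ_ : ℝ → ℝ → ℝ
x +ᵣ y = lim (λ n → approx x n + approx y n) (cauchy-+ (approx x) (approx y) (cauchy x) (cauchy y))

-ᵣ_ : ℝ → ℝ
-ᵣ x = lim (λ n → - approx x n) (cauchy-neg (approx x) (cauchy x))

_-ᵣ_ : ℝ → ℝ → ℝ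
x -ᵣ y = x +ᵣ (-ᵣ y)

_*ᵣ_ : ℝ → ℝ → ℝ
x *ᵣ y = lim (λ n → approx x n * approx y n) (cauchy-* (approx x) (approx y) (cauchy x) (cauchy y))

_^ᵣ_ : ℝ → ℕ → ℝ
x ^ᵣ zero  = fromℚ 1ℚ
x ^ᵣ suc n = x *ᵣ x ^ᵣ n

_/!_ : ℝ → ℕ → ℝ
x /! n = x *ᵣ fromℚ ((ℤ.+ 1 / (n !)) {{n ℕ.!≢0}})

sum₁ : ℕ → (ℕ → ℝ) → ℝ
sum₁ zero    f = fromℚ 0ℚ
sum₁ (suc n) f = sum₁ n f +ᵣ f (suc n)

syntax sum₁ n (λ i → x) = Σ[1≤ i ≤ n ] x

module UnitFractionLemmas where

  u : ℕ → ℚ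
  u n = ℤ.+ 1 / suc n

  toℚᵘ-/ : ∀ i n → toℚᵘ (i / suc n) ℚᵘ.≃ ℚᵘ.mkℚᵘ i n
  toℚᵘ-/ i n = toℚᵘ-fromℚᵘ (ℚᵘ.mkℚᵘ i n)

  0<u : ∀ n → 0ℚ < u n
  0<u n = positive⁻¹ (u n) {{normalize-pos 1 (suc n)}}

  0≤u : ∀ n → 0ℚ ≤ u n
  0≤u n = <⇒≤ (0<u n)

  unit-anti : ∀ a b .{{_ : ℕ.NonZero a}} .{{_ : ℕ.NonZero b}} → b ℕ.≤ a → ℤ.+ 1 / a ≤ ℤ.+ 1 / b
  unit-anti (suc a) (suc b) b≤a = toℚᵘ-cancel-≤ (begin
    toℚᵘ (ℤ.+ 1 / suc a)  ≃⟨ toℚᵘ-/ (ℤ.+ 1) a ⟩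
    ℚᵘ.mkℚᵘ (ℤ.+ 1) a     ≤⟨ ℚᵘ.*≤* (ℤ.*-monoˡ-≤-nonNeg (ℤ.+ 1) (ℤ.+≤+ b≤a)) ⟩
    ℚᵘ.mkℚᵘ (ℤ.+ 1) b     ≃⟨ toℚᵘ-/ (ℤ.+ 1) b ⟨
    toℚᵘ (ℤ.+ 1 / suc b)  ∎)
    where open ℚᵘ.≤-Reasoning

  unit-* : ∀ n → ℤ.+ 1 / (suc n ℕ.* suc n) ≡ u n * u n
  unit-* n = toℚᵘ-injective (begin-equality
    toℚᵘ (ℤ.+ 1 / (suc n ℕ.* suc n))               ≃⟨ toℚᵘ-/ (ℤ.+ 1) (n ℕ.+ n ℕ.* suc n) ⟩
    ℚᵘ.mkℚᵘ (ℤ.+ 1) n ℚᵘ.* ℚᵘ.mkℚᵘ (ℤ.+ 1) n         ≃⟨ ℚᵘ.*-cong (toℚᵘ-/ (ℤ.+ 1) n) (toℚᵘ-/ (ℤ.+ 1) n) ⟨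
    toℚᵘ (u n) ℚᵘ.* toℚᵘ (u n)                   ≃⟨ toℚᵘ-homo-* (u n) (u n) ⟨
    toℚᵘ (u n * u n)                             ∎)
    where open ℚᵘ.≤-Reasoning

  fromℕ-suc : ∀ n → fromℕ (suc n) ≡ 1ℚ + fromℕ n
  fromℕ-suc n = toℚᵘ-injective (begin-equality
    toℚᵘ (fromℕ (suc n))                    ≃⟨ toℚᵘ-/ (ℤ.+ suc n) 0 ⟩
    ℚᵘ.mkℚᵘ (ℤ.+ suc n) 0                     ≃⟨ ℚᵘ.*≡* (cong (ℤ._* ℤ.+ 1) (cong (ℤ._+_ (ℤ.+ 1)) (sym (ℤ.*-identityʳ (ℤ.+ n))))) ⟩
    ℚᵘ.mkℚᵘ (ℤ.+ 1) 0 ℚᵘ.+ ℚᵘ.mkℚᵘ (ℤ.+ n) 0    ≃⟨ ℚᵘ.+-cong (toℚᵘ-/ (ℤ.+ 1) 0) (toℚᵘ-/ (ℤ.+ n) 0) ⟨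
    toℚᵘ 1ℚ ℚᵘ.+ toℚᵘ (fromℕ n)             ≃⟨ toℚᵘ-homo-+ 1ℚ (fromℕ n) ⟨
    toℚᵘ (1ℚ + fromℕ n)                     ∎)
    where open ℚᵘ.≤-Reasoning

  fromℕ*u : ∀ n → fromℕ (suc n) * u n ≡ 1ℚ
  fromℕ*u n = toℚᵘ-injective (begin-equality
    toℚᵘ (fromℕ (suc n) * u n)                 ≃⟨ toℚᵘ-homo-* (fromℕ (suc n)) (u n) ⟩
    toℚᵘ (fromℕ (suc n)) ℚᵘ.* toℚᵘ (u n)       ≃⟨ ℚᵘ.*-cong (toℚᵘ-/ (ℤ.+ suc n) 0) (toℚᵘ-/ (ℤ.+ 1) n) ⟩
    ℚᵘ.mkℚᵘ (ℤ.+ suc n) 0 ℚᵘ.* ℚᵘ.mkℚᵘ (ℤ.+ 1) n   ≃⟨ ℚᵘ.*≡* (cong ℤ.+_ (trans (ℕ.*-identityʳ (suc n ℕ.* 1))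
                                                      (trans (ℕ.*-comm (suc n) 1)
                                                             (sym (ℕ.*-identityˡ (1 ℕ.* suc n)))))) ⟩
    toℚᵘ 1ℚ                                    ∎)
    where open ℚᵘ.≤-Reasoning

  fromℕ-+ : ∀ m n → fromℕ (m ℕ.+ n) ≡ fromℕ m + fromℕ n
  fromℕ-+ zero    n = sym (+-identityˡ (fromℕ n))
  fromℕ-+ (suc m) n = begin
    fromℕ (suc (m ℕ.+ n))       ≡⟨ fromℕ-suc (m ℕ.+ n) ⟩
    1ℚ + fromℕ (m ℕ.+ n)        ≡⟨ cong (1ℚ +_) (fromℕ-+ m n) ⟩
    1ℚ + (fromℕ m + fromℕ n)    ≡⟨ +-assoc 1ℚ (fromℕ m) (fromℕ n) ⟨
    1ℚ + fromℕ m + fromℕ n      ≡⟨ cong (_+ fromℕ n) (fromℕ-suc m) ⟨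
    fromℕ (suc m) + fromℕ n     ∎
    where open ≡-Reasoning

  fromℕ-* : ∀ m n → fromℕ (m ℕ.* n) ≡ fromℕ m * fromℕ n
  fromℕ-* zero    n = sym (*-zeroˡ (fromℕ n))
  fromℕ-* (suc m) n = begin
    fromℕ (n ℕ.+ m ℕ.* n)           ≡⟨ fromℕ-+ n (m ℕ.* n) ⟩
    fromℕ n + fromℕ (m ℕ.* n)       ≡⟨ cong (fromℕ n +_) (fromℕ-* m n) ⟩
    fromℕ n + fromℕ m * fromℕ n     ≡⟨ eq (fromℕ m) (fromℕ n) ⟩
    (1ℚ + fromℕ m) * fromℕ n        ≡⟨ cong (_* fromℕ n) (fromℕ-suc m) ⟨
    fromℕ (suc m) * fromℕ n         ∎
    where
    open ≡-Reasoning
    eq : ∀ m n → n + m * n ≡ (1ℚ + m) * n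
    eq = solve-∀ ℚ-ring

  0≤fromℕ : ∀ n → 0ℚ ≤ fromℕ n
  0≤fromℕ n = nonNegative⁻¹ (fromℕ n) {{normalize-nonNeg n 1}}

  fromℕ-mono : ∀ {m n} → m ℕ.≤ n → fromℕ m ≤ fromℕ n
  fromℕ-mono {m} m≤n with ℕ.m≤n⇒∃[o]m+o≡n m≤n
  ... | o , refl = subst (fromℕ m ≤_) (sym (fromℕ-+ m o)) (a≤a+b (0≤fromℕ o))

  u≤1 : ∀ n → u n ≤ 1ℚ
  u≤1 n = unit-anti (suc n) 1 (s≤s z≤n)

  u-step : ∀ n → u n ≡ u (suc n) + u n * u (suc n)
  u-step n = begin
    u n                                        ≡⟨ *-identityʳ (u n) ⟨
    u n * 1ℚ                                   ≡⟨ cong (u n *_) (fromℕ*u (suc n)) ⟨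
    u n * (fromℕ (suc (suc n)) * u (suc n))    ≡⟨ cong (λ t → u n * (t * u (suc n))) (fromℕ-suc (suc n)) ⟩
    u n * ((1ℚ + fromℕ (suc n)) * u (suc n))   ≡⟨ eq (u n) (fromℕ (suc n)) (u (suc n)) ⟩
    fromℕ (suc n) * u n * u (suc n) + u n * u (suc n)
                                               ≡⟨ cong (λ t → t * u (suc n) + u n * u (suc n)) (fromℕ*u n) ⟩
    1ℚ * u (suc n) + u n * u (suc n)           ≡⟨ cong (_+ u n * u (suc n)) (*-identityˡ (u (suc n))) ⟩
    u (suc n) + u n * u (suc n)                ∎
    where
    open ≡-Reasoning
    eq : ∀ a b c → a * ((1ℚ + b) * c) ≡ b * a * c + a * c
    eq = solve-∀ ℚ-ring

  -- v n = 1/((n+1)(n+2)) = 1/(n+1) − 1/(n+2)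
  v : ℕ → ℚ
  v n = u n * u (suc n)

  0≤v : ∀ n → 0ℚ ≤ v n
  0≤v n = *-nonneg (0≤u n) (0≤u (suc n))

  v-diff : ∀ n → v n ≡ u n - u (suc n)
  v-diff n = trans (eq (u (suc n)) (v n)) (cong (_- u (suc n)) (sym (u-step n)))
    where
    eq : ∀ a b → b ≡ a + b - a
    eq = solve-∀ ℚ-ring

  u²≤2v : ∀ n → u n * u n ≤ v n + v n
  u²≤2v n = subst (u n * u n ≤_) (*-distribˡ-+ (u n) (u (suc n)) (u (suc n)))
    (*-monoˡ-≤-nonNeg (u n) {{nonNegative (0≤u n)}} u≤2u)
    where
    u≤2u : u n ≤ u (suc n) + u (suc n)
    u≤2u = begin
      u n                           ≡⟨ u-step n ⟩
      u (suc n) + u n * u (suc n)   ≤⟨ +-monoʳ-≤ (u (suc n)) (*-mono-≤ (0≤u n) (u≤1 n) (0≤u (suc n)) ≤-refl) ⟩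
      u (suc n) + 1ℚ * u (suc n)    ≡⟨ cong (u (suc n) +_) (*-identityˡ (u (suc n))) ⟩
      u (suc n) + u (suc n)         ∎
      where open ≤-Reasoning

  archimedean : ∀ ε → 0ℚ < ε → ∃ λ N → ∀ n → N ℕ.≤ n → u n < ε
  archimedean ε 0<ε = go ε (positive 0<ε)
    where
    go : ∀ ε → Positive ε → ∃ λ N → ∀ n → N ℕ.≤ n → u n < ε
    go ε@(mkℚ +[1+ a ] d _) _ = suc d , λ n d<n → toℚᵘ-cancel-< (ℚᵘ.<-respˡ-≃ (ℚᵘ.≃-sym (toℚᵘ-/ (ℤ.+ 1) n))
      (ℚᵘ.*<* (subst (ℤ._< ℤ.+ (suc a ℕ.* suc n)) (sym (ℤ.*-identityˡ (ℤ.+ suc d)))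
        (ℤ.+<+ (ℕ.<-≤-trans (s≤s d<n) (ℕ.m≤n*m (suc n) (suc a)))))))

  u-null : IsNull u
  u-null ε 0<ε with archimedean ε 0<ε
  ... | N , f = N , λ n N≤n → subst (_< ε) (sym (0≤p⇒∣p∣≡p (0≤u n))) (f n N≤n)

  -- Cesàro: if h increases by q n at step n and q → 0, then h n / (n+1) → 0.
  cesàro : (h q : ℕ → ℚ) → (∀ n → h (suc n) ≡ h n + q n) → IsNull q → IsNull (λ n → u n * h n)
  cesàro h q step nq ε 0<ε with nq (½ * ε) (half-pos 0<ε)
  ... | N , f = M ℕ.⊔ N , λ n le →
    bound n (proj₂ small n (ℕ.m⊔n≤o⇒m≤o M N le)) (ℕ.m⊔n≤o⇒n≤o M N le)
    where
    small : ∃ λ M → ∀ n → M ℕ.≤ n → ∣ ∣ h N ∣ * u n ∣ < ½ * ε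
    small = null-scale (∣ h N ∣) u u-null (½ * ε) (half-pos 0<ε)
    M : ℕ
    M = proj₁ small
    open ≤-Reasoning
    δ : ℚ
    δ = ½ * ε
    eq : ∀ a b c → a + b * c + c ≡ a + (1ℚ + b) * c
    eq = solve-∀ ℚ-ring
    eq₂ : ∀ a b c d → a * (b + c * d) ≡ b * a + c * a * d
    eq₂ = solve-∀ ℚ-ring
    growth : ∀ k → ∣ h (k ℕ.+ N) ∣ ≤ ∣ h N ∣ + fromℕ k * δ
    growth zero    = ≤-reflexive (sym (trans (cong (∣ h N ∣ +_) (*-zeroˡ δ)) (+-identityʳ ∣ h N ∣)))
    growth (suc k) = begin
      ∣ h (suc k ℕ.+ N) ∣                     ≡⟨ cong ∣_∣ (step (k ℕ.+ N)) ⟩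
      ∣ h (k ℕ.+ N) + q (k ℕ.+ N) ∣           ≤⟨ ∣p+q∣≤∣p∣+∣q∣ (h (k ℕ.+ N)) (q (k ℕ.+ N)) ⟩
      ∣ h (k ℕ.+ N) ∣ + ∣ q (k ℕ.+ N) ∣       ≤⟨ +-mono-≤ (growth k) (<⇒≤ (f (k ℕ.+ N) (ℕ.m≤n+m N k))) ⟩
      ∣ h N ∣ + fromℕ k * δ + δ               ≡⟨ eq ∣ h N ∣ (fromℕ k) δ ⟩
      ∣ h N ∣ + (1ℚ + fromℕ k) * δ            ≡⟨ cong (λ t → ∣ h N ∣ + t * δ) (fromℕ-suc k) ⟨
      ∣ h N ∣ + fromℕ (suc k) * δ             ∎
    bound : ∀ n → ∣ ∣ h N ∣ * u n ∣ < δ → N ℕ.≤ n → ∣ u n * h n ∣ < ε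
    bound n hu<δ N≤n with ℕ.m≤n⇒∃[o]m+o≡n N≤n
    ... | k , N+k≡n = begin-strict
      ∣ u n * h n ∣                          ≡⟨ ∣p*q∣≡∣p∣*∣q∣ (u n) (h n) ⟩
      ∣ u n ∣ * ∣ h n ∣                      ≡⟨ cong (_* ∣ h n ∣) (0≤p⇒∣p∣≡p (0≤u n)) ⟩
      u n * ∣ h n ∣                          ≤⟨ *-monoˡ-≤-nonNeg (u n) {{nonNegative (0≤u n)}}
                                                  (subst (λ t → ∣ h t ∣ ≤ ∣ h N ∣ + fromℕ k * δ) k+N≡n (growth k)) ⟩
      u n * (∣ h N ∣ + fromℕ k * δ)          ≡⟨ eq₂ (u n) ∣ h N ∣ (fromℕ k) δ ⟩
      ∣ h N ∣ * u n + fromℕ k * u n * δ      ≤⟨ +-monoʳ-≤ (∣ h N ∣ * u n) (*-monoʳ-≤-nonNeg δ {{nonNegative (<⇒≤ (half-pos 0<ε))}} ku≤1) ⟩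
      ∣ h N ∣ * u n + 1ℚ * δ                 ≡⟨ cong (∣ h N ∣ * u n +_) (*-identityˡ δ) ⟩
      ∣ h N ∣ * u n + δ                      ≤⟨ +-monoˡ-≤ δ (x≤∣x∣ (∣ h N ∣ * u n)) ⟩
      ∣ ∣ h N ∣ * u n ∣ + δ                  <⟨ +-monoˡ-< δ hu<δ ⟩
      δ + δ                                  ≡⟨ ½+½ ε ⟩
      ε                                      ∎
      where
      k+N≡n : k ℕ.+ N ≡ n
      k+N≡n = trans (ℕ.+-comm k N) N+k≡n
      k≤n : k ℕ.≤ suc n
      k≤n = ℕ.m≤n⇒m≤1+n (subst (k ℕ.≤_) k+N≡n (ℕ.m≤m+n k N))
      ku≤1 : fromℕ k * u n ≤ 1ℚ
      ku≤1 = subst (fromℕ k * u n ≤_) (fromℕ*u n)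
        (*-monoʳ-≤-nonNeg (u n) {{nonNegative (0≤u n)}} (fromℕ-mono k≤n))

  telescope : (x D : ℕ → ℚ) → (∀ n → ∣ x (suc n) - x n ∣ ≤ D n - D (suc n)) →
              (n k : ℕ) → ∣ x (k ℕ.+ n) - x n ∣ ≤ D n - D (k ℕ.+ n)
  telescope x D step n zero    =
    ≤-reflexive (trans (cong ∣_∣ (+-inverseʳ (x n))) (sym (+-inverseʳ (D n))))
  telescope x D step n (suc k) = begin
    ∣ x (suc k ℕ.+ n) - x n ∣
      ≤⟨ triangle (x (suc k ℕ.+ n)) (x (k ℕ.+ n)) (x n) ⟩
    ∣ x (suc k ℕ.+ n) - x (k ℕ.+ n) ∣ + ∣ x (k ℕ.+ n) - x n ∣
      ≤⟨ +-mono-≤ (step (k ℕ.+ n)) (telescope x D step n k) ⟩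
    (D (k ℕ.+ n) - D (suc k ℕ.+ n)) + (D n - D (k ℕ.+ n))
      ≡⟨ eq (D (k ℕ.+ n)) (D (suc k ℕ.+ n)) (D n) ⟩
    D n - D (suc k ℕ.+ n) ∎
    where
    open ≤-Reasoning
    eq : ∀ a b c → (a - b) + (c - a) ≡ c - b
    eq = solve-∀ ℚ-ring

  telescope-cauchy : (x D : ℕ → ℚ) → (∀ n → ∣ x (suc n) - x n ∣ ≤ D n - D (suc n)) →
                     IsNull D → IsCauchy x
  telescope-cauchy x D step nD ε 0<ε with nD (½ * ε) (half-pos 0<ε)
  ... | N , f = N , close
    where
    open ≤-Reasoning
    later : ∀ n k → N ℕ.≤ n → ∣ x (k ℕ.+ n) - x n ∣ < ε
    later n k N≤n = begin-strict
      ∣ x (k ℕ.+ n) - x n ∣            ≤⟨ telescope x D step n k ⟩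
      D n - D (k ℕ.+ n)                ≤⟨ +-mono-≤ (x≤∣x∣ (D n)) (-x≤∣x∣ (D (k ℕ.+ n))) ⟩
      ∣ D n ∣ + ∣ D (k ℕ.+ n) ∣        <⟨ +-mono-< (f n N≤n) (f (k ℕ.+ n) (ℕ.m≤n⇒m≤o+n k N≤n)) ⟩
      ½ * ε + ½ * ε                    ≡⟨ ½+½ ε ⟩
      ε                                ∎
    ordered : ∀ m n → N ℕ.≤ n → n ℕ.≤ m → ∣ x m - x n ∣ < ε
    ordered m n N≤n n≤m with ℕ.m≤n⇒∃[o]m+o≡n n≤m
    ... | k , n+k≡m = subst (λ t → ∣ x t - x n ∣ < ε) (trans (ℕ.+-comm k n) n+k≡m) (later n k N≤n)
    close : ∀ m n → N ℕ.≤ m → N ℕ.≤ n → ∣ x m - x n ∣ < ε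
    close m n N≤m N≤n with ℕ.≤-total n m
    ... | inj₁ n≤m = ordered m n N≤n n≤m
    ... | inj₂ m≤n = subst (_< ε) (∣-∣-sym (x n) (x m)) (ordered n m N≤m m≤n)

  -- Nested harmonic sums of depth d; they dominate all alternating ones.
  h : ℕ → ℕ → ℚ
  h zero    n       = 1ℚ
  h (suc d) zero    = 0ℚ
  h (suc d) (suc n) = h (suc d) n + u n * h d n

  0≤h : ∀ d n → 0ℚ ≤ h d n
  0≤h zero    n       = <⇒≤ 0<1
  0≤h (suc d) zero    = ≤-refl
  0≤h (suc d) (suc n) = +-nonneg (0≤h (suc d) n) (*-nonneg (0≤u n) (0≤h d n))

  p : ℕ → ℕ → ℚ
  p d n = u n * h d n

  p-null : ∀ d → IsNull (p d)
  p-null zero    = null-≤ (p 0) u (λ n → ≤-reflexive (cong ∣_∣ (*-identityʳ (u n)))) u-null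
  p-null (suc d) = cesàro (h (suc d)) (p d) (λ n → refl) (p-null d)

  -- B d is the tail Σ_{j ≥ n} v j · h d j in closed form.
  B : ℕ → ℕ → ℚ
  B zero    n = p 0 n
  B (suc d) n = p (suc d) n + B d n

  B-null : ∀ d → IsNull (B d)
  B-null zero    = p-null 0
  B-null (suc d) = null-+ (p (suc d)) (B d) (p-null (suc d)) (B-null d)

  B-diff : ∀ d n → v n * h d n ≡ B d n - B d (suc n)
  B-diff zero    n = trans (cong (_* 1ℚ) (v-diff n)) (eq (u n) (u (suc n)))
    where
    eq : ∀ a b → (a - b) * 1ℚ ≡ a * 1ℚ - b * 1ℚ
    eq = solve-∀ ℚ-ring
  B-diff (suc d) n = begin
    v n * H                                           ≡⟨ cong (_* H) (v-diff n) ⟩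
    (u n - u (suc n)) * H                             ≡⟨ eq (u n) (u (suc n)) H (h d n) ⟩
    (u n * H - u (suc n) * (H + u n * h d n)) + v n * h d n
                                                      ≡⟨ cong (u n * H - u (suc n) * (H + u n * h d n) +_) (B-diff d n) ⟩
    (u n * H - u (suc n) * (H + u n * h d n)) + (B d n - B d (suc n))
                                                      ≡⟨ eq′ (u n * H) (u (suc n) * (H + u n * h d n)) (B d n) (B d (suc n)) ⟩
    B (suc d) n - B (suc d) (suc n)                   ∎
    where
    open ≡-Reasoning
    H : ℚ
    H = h (suc d) n
    eq : ∀ a b c d → (a - b) * c ≡ (a * c - b * (c + a * d)) + a * b * d
    eq = solve-∀ ℚ-ring
    eq′ : ∀ a b c d → (a - b) + (c - d) ≡ (a + c) - (b + d)
    eq′ = solve-∀ ℚ-ring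

open UnitFractionLemmas

-- bar s stands for s̄.
data Entry : Set where
  plain bar : (s : ℕ) → .{{_ : ℕ.NonZero s}} → Entry

ones : ℕ → List Entry
ones r = replicate r (plain 1)

infix 8 -1^_

-1^_ : ℕ → ℚ
-1^ zero  = 1ℚ
-1^ suc n = - (-1^ n)

unitFraction^ : (s k : ℕ) → .{{_ : ℕ.NonZero k}} → ℚ
unitFraction^ s k = (ℤ.+ 1 / (k ℕ.^ s)) {{ℕ.m^n≢0 k s}}

factor : Entry → (k : ℕ) → .{{_ : ℕ.NonZero k}} → ℚ
factor (plain s) k = unitFraction^ s k
factor (bar s)   k = -1^ k * unitFraction^ s k

-- partialSum (s₁ ∷ … ∷ sᵣ) n is the sum over n ≥ k₁ > ⋯ > kᵣ ≥ 1, computed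
-- by recursion on the largest admitted value of k₁: the terms with
-- k₁ = n + 1 contribute factor s₁ (n + 1) times the sum over
-- n ≥ k₂ > ⋯ > kᵣ ≥ 1.
partialSum : List Entry → ℕ → ℚ
partialSum []      n       = 1ℚ
partialSum (e ∷ s) zero    = 0ℚ
partialSum (e ∷ s) (suc n) = partialSum (e ∷ s) n + factor e (suc n) * partialSum s n

-- The usual sufficient condition for convergence: the first entry is not an
-- unbarred 1.
Admissible : List Entry → Set
Admissible (plain 1 ∷ _) = ⊥
Admissible _             = ⊤

module PartialSumLemmas where

  ∣-1^∣ : ∀ n → ∣ -1^ n ∣ ≡ 1ℚ
  ∣-1^∣ zero    = refl
  ∣-1^∣ (suc n) = trans (∣-p∣≡∣p∣ (-1^ n)) (∣-1^∣ n)

  0≤unitFraction : ∀ s n → 0ℚ ≤ unitFraction^ s (suc n)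
  0≤unitFraction s n =
    nonNegative⁻¹ (unitFraction^ s (suc n))
      {{normalize-nonNeg 1 (suc n ℕ.^ s) {{ℕ.m^n≢0 (suc n) s}}}}

  ∣factor∣ : ∀ (P : ℚ → Set) n →
             (∀ s → .{{_ : ℕ.NonZero s}} → P (unitFraction^ s (suc n))) →
             ∀ e → P ∣ factor e (suc n) ∣
  ∣factor∣ P n f (plain s) = subst P (sym (0≤p⇒∣p∣≡p (0≤unitFraction s n))) (f s)
  ∣factor∣ P n f (bar s)   = subst P (sym eq) (f s)
    where
    q : ℚ
    q = unitFraction^ s (suc n)
    eq : ∣ -1^ suc n * q ∣ ≡ q
    eq = trans (∣p*q∣≡∣p∣*∣q∣ (-1^ suc n) q)
         (trans (cong₂ _*_ (∣-1^∣ (suc n)) (0≤p⇒∣p∣≡p (0≤unitFraction s n))) (*-identityˡ q))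

  unitFraction-≤ : ∀ s n → .{{_ : ℕ.NonZero s}} → unitFraction^ s (suc n) ≤ u n
  unitFraction-≤ zero    n {{s≢0}} = ⊥-elim (ℕ.≢-nonZero⁻¹ 0 {{s≢0}} refl)
  unitFraction-≤ (suc s) n = unit-anti (suc n ℕ.^ suc s) (suc n) {{ℕ.m^n≢0 (suc n) (suc s)}}
    (ℕ.m≤m*n (suc n) (suc n ℕ.^ s) {{ℕ.m^n≢0 (suc n) s}})

  unitFraction-≤² : ∀ s n → unitFraction^ (suc (suc s)) (suc n) ≤ u n * u n
  unitFraction-≤² s n = subst (unitFraction^ (suc (suc s)) (suc n) ≤_) (unit-* n)
    (unit-anti (suc n ℕ.^ suc (suc s)) (suc n ℕ.* suc n) {{ℕ.m^n≢0 (suc n) (suc (suc s))}}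
      (ℕ.*-monoʳ-≤ (suc n) (ℕ.m≤m*n (suc n) (suc n ℕ.^ s) {{ℕ.m^n≢0 (suc n) s}})))

  factor-≤ : ∀ e n → ∣ factor e (suc n) ∣ ≤ u n
  factor-≤ e n = ∣factor∣ (_≤ u n) n (λ s → unitFraction-≤ s n) e

  partialSum-≤ : ∀ s n → ∣ partialSum s n ∣ ≤ h (length s) n
  increment-≤ : ∀ e s n → ∣ factor e (suc n) * partialSum s n ∣ ≤ u n * h (length s) n

  partialSum-≤ []      n       = ≤-refl
  partialSum-≤ (e ∷ s) zero    = ≤-refl
  partialSum-≤ (e ∷ s) (suc n) = ≤-trans
    (∣p+q∣≤∣p∣+∣q∣ (partialSum (e ∷ s) n) (factor e (suc n) * partialSum s n))
    (+-mono-≤ (partialSum-≤ (e ∷ s) n) (increment-≤ e s n))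

  increment-≤ e s n = subst (_≤ u n * h (length s) n)
    (sym (∣p*q∣≡∣p∣*∣q∣ (factor e (suc n)) (partialSum s n)))
    (*-mono-≤ (0≤∣p∣ (factor e (suc n))) (factor-≤ e n) (0≤∣p∣ (partialSum s n)) (partialSum-≤ s n))

  add-sub : ∀ a b → b ≡ a + b - a
  add-sub = solve-∀ ℚ-ring

  absolute : ∀ e s → (∀ n → ∣ factor e (suc n) ∣ ≤ u n * u n) → IsCauchy (partialSum (e ∷ s))
  absolute e s e≤u² = telescope-cauchy (partialSum (e ∷ s)) (λ n → B d n + B d n) step
    (null-+ (B d) (B d) (B-null d) (B-null d))
    where
    open ≤-Reasoning
    d : ℕ
    d = length s
    eq : ∀ a b → (a - b) + (a - b) ≡ (a + a) - (b + b)
    eq = solve-∀ ℚ-ring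
    step : ∀ n → ∣ partialSum (e ∷ s) (suc n) - partialSum (e ∷ s) n ∣
                 ≤ (B d n + B d n) - (B d (suc n) + B d (suc n))
    step n = begin
      ∣ partialSum (e ∷ s) (suc n) - partialSum (e ∷ s) n ∣
        ≡⟨ cong ∣_∣ (add-sub (partialSum (e ∷ s) n) (factor e (suc n) * partialSum s n)) ⟨
      ∣ factor e (suc n) * partialSum s n ∣
        ≡⟨ ∣p*q∣≡∣p∣*∣q∣ (factor e (suc n)) (partialSum s n) ⟩
      ∣ factor e (suc n) ∣ * ∣ partialSum s n ∣
        ≤⟨ *-mono-≤ (0≤∣p∣ (factor e (suc n))) (≤-trans (e≤u² n) (u²≤2v n))
                    (0≤∣p∣ (partialSum s n)) (partialSum-≤ s n) ⟩
      (v n + v n) * h d n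
        ≡⟨ *-distribʳ-+ (h d n) (v n) (v n) ⟩
      v n * h d n + v n * h d n
        ≡⟨ cong₂ _+_ (B-diff d n) (B-diff d n) ⟩
      (B d n - B d (suc n)) + (B d n - B d (suc n))
        ≡⟨ eq (B d n) (B d (suc n)) ⟩
      (B d n + B d n) - (B d (suc n) + B d (suc n)) ∎

  -- For a first entry 1̄ the sums σ of Σ (−1)ⁿ⁺¹ a n are recovered from
  -- τ n = 2 σ n − (−1)ⁿ a n, whose increments ±(a (n+1) − a n) are
  -- absolutely summable.
  alternating : ∀ s → IsCauchy (partialSum (bar 1 ∷ s))
  alternating s = cauchy-cong _ σ recover
    (cauchy-* (λ _ → ½) (λ n → τ n + -1^ n * a n) (const-cauchy ½)
      (cauchy-+ τ (λ n → -1^ n * a n) τ-cauchy (null⇒cauchy (λ n → -1^ n * a n) sa-null)))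
    where
    open ≤-Reasoning
    σ g a τ : ℕ → ℚ
    σ = partialSum (bar 1 ∷ s)
    g = partialSum s
    a n = u n * g n
    τ n = σ n + σ n - -1^ n * a n
    d d′ : ℕ
    d  = length s
    d′ = ℕ.pred d

    recover : ∀ n → ½ * (τ n + -1^ n * a n) ≡ σ n
    recover n = eq (σ n) (-1^ n * a n)
      where
      eq : ∀ x y → ½ * (x + x - y + y) ≡ x
      eq = solve-∀ ℚ-ring

    ∣sign∣ : ∀ n x → ∣ -1^ n * x ∣ ≡ ∣ x ∣
    ∣sign∣ n x = trans (∣p*q∣≡∣p∣*∣q∣ (-1^ n) x)
      (trans (cong (_* ∣ x ∣) (∣-1^∣ n)) (*-identityˡ ∣ x ∣))

    ∣u*∣ : ∀ n x → ∣ u n * x ∣ ≡ u n * ∣ x ∣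
    ∣u*∣ n x = trans (∣p*q∣≡∣p∣*∣q∣ (u n) x) (cong (_* ∣ x ∣) (0≤p⇒∣p∣≡p (0≤u n)))

    a≤p : ∀ n → ∣ -1^ n * a n ∣ ≤ ∣ p d n ∣
    a≤p n = begin
      ∣ -1^ n * a n ∣   ≡⟨ ∣sign∣ n (a n) ⟩
      ∣ u n * g n ∣     ≡⟨ ∣u*∣ n (g n) ⟩
      u n * ∣ g n ∣     ≤⟨ *-monoˡ-≤-nonNeg (u n) {{nonNegative (0≤u n)}} (partialSum-≤ s n) ⟩
      p d n             ≤⟨ x≤∣x∣ (p d n) ⟩
      ∣ p d n ∣         ∎

    sa-null : IsNull (λ n → -1^ n * a n)
    sa-null = null-≤ (λ n → -1^ n * a n) (p d) a≤p (p-null d)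

    g-step : ∀ n → ∣ g (suc n) - g n ∣ ≤ u n * h d′ n
    g-step = go s
      where
      go : ∀ s n → ∣ partialSum s (suc n) - partialSum s n ∣ ≤ u n * h (ℕ.pred (length s)) n
      go []      n = *-nonneg (0≤u n) (0≤h 0 n)
      go (e ∷ s) n = subst (λ t → ∣ t ∣ ≤ u n * h (length s) n)
        (add-sub (partialSum (e ∷ s) n) (factor e (suc n) * partialSum s n)) (increment-≤ e s n)

    a-step : ∀ n → ∣ a (suc n) - a n ∣ ≤ (B d n + B d′ n) - (B d (suc n) + B d′ (suc n))
    a-step n = begin
      ∣ u (suc n) * g (suc n) - u n * g n ∣
        ≡⟨ cong ∣_∣ (eq (u (suc n)) (g (suc n)) (u n) (g n)) ⟩
      ∣ u (suc n) * (g (suc n) - g n) - (u n - u (suc n)) * g n ∣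
        ≡⟨ cong (λ t → ∣ u (suc n) * (g (suc n) - g n) - t * g n ∣) (v-diff n) ⟨
      ∣ u (suc n) * (g (suc n) - g n) - v n * g n ∣
        ≤⟨ ∣p-q∣≤∣p∣+∣q∣ (u (suc n) * (g (suc n) - g n)) (v n * g n) ⟩
      ∣ u (suc n) * (g (suc n) - g n) ∣ + ∣ v n * g n ∣
        ≡⟨ cong₂ _+_ (∣u*∣ (suc n) (g (suc n) - g n))
             (trans (∣p*q∣≡∣p∣*∣q∣ (v n) (g n)) (cong (_* ∣ g n ∣) (0≤p⇒∣p∣≡p (0≤v n)))) ⟩
      u (suc n) * ∣ g (suc n) - g n ∣ + v n * ∣ g n ∣
        ≤⟨ +-mono-≤ (*-monoˡ-≤-nonNeg (u (suc n)) {{nonNegative (0≤u (suc n))}} (g-step n))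
                    (*-monoˡ-≤-nonNeg (v n) {{nonNegative (0≤v n)}} (partialSum-≤ s n)) ⟩
      u (suc n) * (u n * h d′ n) + v n * h d n
        ≡⟨ eq₂ (u (suc n)) (u n) (h d′ n) (v n * h d n) ⟩
      v n * h d n + v n * h d′ n
        ≡⟨ cong₂ _+_ (B-diff d n) (B-diff d′ n) ⟩
      (B d n - B d (suc n)) + (B d′ n - B d′ (suc n))
        ≡⟨ eq₃ (B d n) (B d (suc n)) (B d′ n) (B d′ (suc n)) ⟩
      (B d n + B d′ n) - (B d (suc n) + B d′ (suc n)) ∎
      where
      eq : ∀ u′ g′ u g → u′ * g′ - u * g ≡ u′ * (g′ - g) - (u - u′) * g
      eq = solve-∀ ℚ-ring
      eq₂ : ∀ x y z w → x * (y * z) + w ≡ w + y * x * z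
      eq₂ = solve-∀ ℚ-ring
      eq₃ : ∀ x y z w → (x - y) + (z - w) ≡ (x + z) - (y + w)
      eq₃ = solve-∀ ℚ-ring

    fraction¹ : ∀ n → unitFraction^ 1 (suc n) ≡ u n
    fraction¹ n = /-cong {p₁ = ℤ.+ 1} {q₁ = suc n ℕ.^ 1} {p₂ = ℤ.+ 1} {q₂ = suc n} {{ℕ.m^n≢0 (suc n) 1}} refl (ℕ.*-identityʳ (suc n))

    τ-step : ∀ n → τ (suc n) - τ n ≡ -1^ n * (a (suc n) - a n)
    τ-step n = trans (cong (λ t → σ⁺ t + σ⁺ t - -1^ suc n * a (suc n) - τ n) (fraction¹ n))
                     (eq (σ n) (-1^ n) (u n) (g n) (a (suc n)))
      where
      σ⁺ : ℚ → ℚ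
      σ⁺ t = σ n + - (-1^ n) * t * g n
      eq : ∀ σ s u g a′ →
        (σ + - s * u * g) + (σ + - s * u * g) - - s * a′ - (σ + σ - s * (u * g)) ≡ s * (a′ - u * g)
      eq = solve-∀ ℚ-ring

    τ-cauchy : IsCauchy τ
    τ-cauchy = telescope-cauchy τ (λ n → B d n + B d′ n)
      (λ n → subst (_≤ (B d n + B d′ n) - (B d (suc n) + B d′ (suc n)))
        (sym (trans (cong ∣_∣ (τ-step n)) (∣sign∣ n (a (suc n) - a n)))) (a-step n))
      (null-+ (B d) (B d′) (B-null d) (B-null d′))

  partialSum-cauchy : ∀ s → Admissible s → IsCauchy (partialSum s)
  partialSum-cauchy [] _ = const-cauchy 1ℚ
  partialSum-cauchy (plain zero {{s≢0}} ∷ _) _ = ⊥-elim (ℕ.≢-nonZero⁻¹ 0 {{s≢0}} refl)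
  partialSum-cauchy (plain (suc (suc s)) ∷ t) _ = absolute (plain (suc (suc s))) t
    (λ n → subst (_≤ u n * u n) (sym (0≤p⇒∣p∣≡p (0≤unitFraction (suc (suc s)) n))) (unitFraction-≤² s n))
  partialSum-cauchy (bar zero {{s≢0}} ∷ _) _ = ⊥-elim (ℕ.≢-nonZero⁻¹ 0 {{s≢0}} refl)
  partialSum-cauchy (bar (suc zero) ∷ t) _ = alternating t
  partialSum-cauchy (bar (suc (suc s)) ∷ t) _ = absolute (bar (suc (suc s))) t
    (λ n → subst (_≤ u n * u n)
      (sym (trans (∣p*q∣≡∣p∣*∣q∣ (-1^ suc n) (unitFraction^ (suc (suc s)) (suc n)))
           (trans (cong₂ _*_ (∣-1^∣ (suc n)) (0≤p⇒∣p∣≡p (0≤unitFraction (suc (suc s)) n)))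
                  (*-identityˡ (unitFraction^ (suc (suc s)) (suc n))))))
      (unitFraction-≤² s n))

open PartialSumLemmas

ζ : (s : List Entry) → {Admissible s} → ℝ
ζ s {adm} = lim (partialSum s) (partialSum-cauchy s adm)

sumℚ : ℕ → (ℕ → ℚ) → ℚ
sumℚ zero    g = 0ℚ
sumℚ (suc n) g = sumℚ n g + g n

AntitoneOn : (ℚ → ℚ) → ℚ → ℚ → Set
AntitoneOn f a b = ∀ x y → a ≤ x → x ≤ y → y ≤ b → f y ≤ f x

rightSum : (ℚ → ℚ) → ℚ → ℚ → ℕ → ℚ
rightSum f a δ n = sumℚ n (λ i → f (a + fromℕ (suc i) * δ) * δ)

-- n + 1 subintervals, so that there is no empty partition at n = 0.
riemannSum : (ℚ → ℚ) → ℚ → ℚ → ℕ → ℚ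
riemannSum f a b n = rightSum f a ((b - a) * (ℤ.+ 1 / suc n)) (suc n)

module RiemannSumLemmas where

  leftSum : (ℚ → ℚ) → ℚ → ℚ → ℕ → ℚ
  leftSum f a δ n = sumℚ n (λ i → f (a + fromℕ i * δ) * δ)

  sumℚ-cong : ∀ n (f g : ℕ → ℚ) → (∀ i → f i ≡ g i) → sumℚ n f ≡ sumℚ n g
  sumℚ-cong zero    f g eq = refl
  sumℚ-cong (suc n) f g eq = cong₂ _+_ (sumℚ-cong n f g eq) (eq n)

  sumℚ-mono : ∀ n (f g : ℕ → ℚ) → (∀ i → i ℕ.< n → f i ≤ g i) → sumℚ n f ≤ sumℚ n g
  sumℚ-mono zero    f g le = ≤-refl
  sumℚ-mono (suc n) f g le =
    +-mono-≤ (sumℚ-mono n f g (λ i i<n → le i (ℕ.m≤n⇒m≤1+n i<n))) (le n ℕ.≤-refl)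

  sumℚ-const : ∀ n c → sumℚ n (λ _ → c) ≡ fromℕ n * c
  sumℚ-const zero    c = sym (*-zeroˡ c)
  sumℚ-const (suc n) c = trans (cong (_+ c) (sumℚ-const n c))
    (trans (eq (fromℕ n) c) (cong (_* c) (sym (fromℕ-suc n))))
    where
    eq : ∀ n c → n * c + c ≡ (1ℚ + n) * c
    eq = solve-∀ ℚ-ring

  sumℚ-split : ∀ m n g → sumℚ (m ℕ.+ n) g ≡ sumℚ m g + sumℚ n (λ l → g (m ℕ.+ l))
  sumℚ-split m zero    g = trans (cong (λ t → sumℚ t g) (ℕ.+-identityʳ m)) (sym (+-identityʳ (sumℚ m g)))
  sumℚ-split m (suc n) g = begin
    sumℚ (m ℕ.+ suc n) g                                      ≡⟨ cong (λ t → sumℚ t g) (ℕ.+-suc m n) ⟩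
    sumℚ (m ℕ.+ n) g + g (m ℕ.+ n)                            ≡⟨ cong (_+ g (m ℕ.+ n)) (sumℚ-split m n g) ⟩
    sumℚ m g + sumℚ n (λ l → g (m ℕ.+ l)) + g (m ℕ.+ n)
      ≡⟨ +-assoc (sumℚ m g) (sumℚ n (λ l → g (m ℕ.+ l))) (g (m ℕ.+ n)) ⟩
    sumℚ m g + sumℚ (suc n) (λ l → g (m ℕ.+ l))               ∎
    where open ≡-Reasoning

  sumℚ-blocks : ∀ n M g → sumℚ (n ℕ.* M) g ≡ sumℚ n (λ i → sumℚ M (λ l → g (i ℕ.* M ℕ.+ l)))
  sumℚ-blocks zero    M g = refl
  sumℚ-blocks (suc n) M g = begin
    sumℚ (M ℕ.+ n ℕ.* M) g   ≡⟨ cong (λ t → sumℚ t g) (ℕ.+-comm M (n ℕ.* M)) ⟩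
    sumℚ (n ℕ.* M ℕ.+ M) g   ≡⟨ sumℚ-split (n ℕ.* M) M g ⟩
    sumℚ (n ℕ.* M) g + sumℚ M (λ l → g (n ℕ.* M ℕ.+ l))
      ≡⟨ cong (_+ sumℚ M (λ l → g (n ℕ.* M ℕ.+ l))) (sumℚ-blocks n M g) ⟩
    sumℚ (suc n) (λ i → sumℚ M (λ l → g (i ℕ.* M ℕ.+ l))) ∎
    where open ≡-Reasoning

  left-right : ∀ f a δ n →
    leftSum f a δ n ≡ rightSum f a δ n + (f (a + fromℕ 0 * δ) - f (a + fromℕ n * δ)) * δ
  left-right f a δ zero    = eq (f (a + fromℕ 0 * δ)) δ
    where
    eq : ∀ x d → 0ℚ ≡ 0ℚ + (x - x) * d
    eq = solve-∀ ℚ-ring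
  left-right f a δ (suc n) = trans (cong (_+ F n * δ) (left-right f a δ n))
    (eq (rightSum f a δ n) (F 0) (F n) (F (suc n)) δ)
    where
    F : ℕ → ℚ
    F i = f (a + fromℕ i * δ)
    eq : ∀ r x y z d → r + (x - y) * d + y * d ≡ r + z * d + (x - z) * d
    eq = solve-∀ ℚ-ring

  -- Splitting each of n intervals into M pieces of length δ raises the
  -- right sum of an antitone function and lowers its left sum.
  module Refine (f : ℚ → ℚ) (a b δ : ℚ) (0≤δ : 0ℚ ≤ δ) (anti : AntitoneOn f a b)
                (n M : ℕ) (end : a + fromℕ (n ℕ.* M) * δ ≡ b) where

    point : ℕ → ℚ
    point i = a + fromℕ i * δ

    point-mono : ∀ {i j} → i ℕ.≤ j → point i ≤ point j
    point-mono i≤j = +-monoʳ-≤ a (*-monoʳ-≤-nonNeg δ {{nonNegative 0≤δ}} (fromℕ-mono i≤j))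

    f-anti : ∀ {i j} → i ℕ.≤ j → j ℕ.≤ n ℕ.* M → f (point j) * δ ≤ f (point i) * δ
    f-anti {i} {j} i≤j j≤nM = *-monoʳ-≤-nonNeg δ {{nonNegative 0≤δ}}
      (anti (point i) (point j) (a≤a+b (*-nonneg (0≤fromℕ i) 0≤δ)) (point-mono i≤j)
        (subst (point j ≤_) end (point-mono j≤nM)))

    coarse : ∀ i → f (a + fromℕ i * (fromℕ M * δ)) * (fromℕ M * δ)
                   ≡ sumℚ M (λ _ → f (point (i ℕ.* M)) * δ)
    coarse i = begin
      f (a + fromℕ i * (fromℕ M * δ)) * (fromℕ M * δ)
        ≡⟨ cong (λ t → f (a + t) * (fromℕ M * δ)) (*-assoc (fromℕ i) (fromℕ M) δ) ⟨
      f (a + fromℕ i * fromℕ M * δ) * (fromℕ M * δ)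
        ≡⟨ cong (λ t → f (a + t * δ) * (fromℕ M * δ)) (fromℕ-* i M) ⟨
      f (point (i ℕ.* M)) * (fromℕ M * δ)
        ≡⟨ eq (f (point (i ℕ.* M))) (fromℕ M) δ ⟩
      fromℕ M * (f (point (i ℕ.* M)) * δ)
        ≡⟨ sumℚ-const M (f (point (i ℕ.* M)) * δ) ⟨
      sumℚ M (λ _ → f (point (i ℕ.* M)) * δ) ∎
      where
      open ≡-Reasoning
      eq : ∀ x y z → x * (y * z) ≡ y * (x * z)
      eq = solve-∀ ℚ-ring

    in-block : ∀ {i l} → l ℕ.< M → suc (i ℕ.* M ℕ.+ l) ℕ.≤ suc i ℕ.* M
    in-block {i} {l} l<M = subst (ℕ._≤ suc i ℕ.* M) (ℕ.+-suc (i ℕ.* M) l)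
      (subst (i ℕ.* M ℕ.+ suc l ℕ.≤_) (ℕ.+-comm (i ℕ.* M) M) (ℕ.+-monoʳ-≤ (i ℕ.* M) l<M))

    right-≤ : rightSum f a (fromℕ M * δ) n ≤ rightSum f a δ (n ℕ.* M)
    right-≤ = begin
      rightSum f a (fromℕ M * δ) n
        ≡⟨ sumℚ-cong n _ _ (λ i → coarse (suc i)) ⟩
      sumℚ n (λ i → sumℚ M (λ _ → f (point (suc i ℕ.* M)) * δ))
        ≤⟨ sumℚ-mono n _ _ (λ i i<n → sumℚ-mono M _ _ (λ l l<M →
             f-anti (in-block {i} l<M) (ℕ.*-monoˡ-≤ M i<n))) ⟩
      sumℚ n (λ i → sumℚ M (λ l → f (point (suc (i ℕ.* M ℕ.+ l))) * δ))
        ≡⟨ sumℚ-blocks n M (λ i → f (point (suc i)) * δ) ⟨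
      rightSum f a δ (n ℕ.* M) ∎
      where open ≤-Reasoning

    left-≥ : leftSum f a δ (n ℕ.* M) ≤ leftSum f a (fromℕ M * δ) n
    left-≥ = begin
      leftSum f a δ (n ℕ.* M)
        ≡⟨ sumℚ-blocks n M (λ i → f (point i) * δ) ⟩
      sumℚ n (λ i → sumℚ M (λ l → f (point (i ℕ.* M ℕ.+ l)) * δ))
        ≤⟨ sumℚ-mono n _ _ (λ i i<n → sumℚ-mono M _ _ (λ l l<M →
             f-anti (ℕ.m≤m+n (i ℕ.* M) l)
               (ℕ.≤-trans (ℕ.<⇒≤ (in-block {i} l<M)) (ℕ.*-monoˡ-≤ M i<n)))) ⟩
      sumℚ n (λ i → sumℚ M (λ _ → f (point (i ℕ.* M)) * δ))
        ≡⟨ sumℚ-cong n _ _ coarse ⟨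
      leftSum f a (fromℕ M * δ) n ∎
      where open ≤-Reasoning

  module Integral (f : ℚ → ℚ) (a b : ℚ) (a≤b : a ≤ b) (anti : AntitoneOn f a b) where

    δ : ℕ → ℚ
    δ n = (b - a) * u n

    C : ℚ
    C = (f a - f b) * (b - a)

    0≤δ : ∀ n → 0ℚ ≤ δ n
    0≤δ n = *-nonneg (≤⇒0≤- a≤b) (0≤u n)

    start : ∀ d → a + fromℕ 0 * d ≡ a
    start d = trans (cong (a +_) (*-zeroˡ d)) (+-identityʳ a)

    b-end : ∀ n → a + fromℕ (suc n) * δ n ≡ b
    b-end n = begin
      a + fromℕ (suc n) * ((b - a) * u n)   ≡⟨ eq a b (fromℕ (suc n)) (u n) ⟩
      a + (b - a) * (fromℕ (suc n) * u n)   ≡⟨ cong (λ t → a + (b - a) * t) (fromℕ*u n) ⟩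
      a + (b - a) * 1ℚ                      ≡⟨ eq′ a b ⟩
      b                                     ∎
      where
      open ≡-Reasoning
      eq : ∀ a b n u → a + n * ((b - a) * u) ≡ a + (b - a) * (n * u)
      eq = solve-∀ ℚ-ring
      eq′ : ∀ a b → a + (b - a) * 1ℚ ≡ b
      eq′ = solve-∀ ℚ-ring

    left-right-ab : ∀ d n → a + fromℕ n * d ≡ b → leftSum f a d n ≡ rightSum f a d n + (f a - f b) * d
    left-right-ab d n end = trans (left-right f a d n)
      (cong₂ (λ s t → rightSum f a d n + (f s - f t) * d) (start d) end)

    fine : ∀ m n → fromℕ (suc m) * (δ n * u m) ≡ δ n
    fine m n = trans (eq (fromℕ (suc m)) (δ n) (u m)) (trans (cong (δ n *_) (fromℕ*u m)) (*-identityʳ (δ n)))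
      where
      eq : ∀ x y z → x * (y * z) ≡ y * (x * z)
      eq = solve-∀ ℚ-ring

    0≤fa-fb : 0ℚ ≤ f a - f b
    0≤fa-fb = ≤⇒0≤- (anti a b ≤-refl a≤b ≤-refl)

    compare : ∀ n m → riemannSum f a b n ≤ riemannSum f a b m + C * u m
    compare n m = begin
      rightSum f a (δ n) (suc n)                        ≡⟨ cong (λ t → rightSum f a t (suc n)) (fine m n) ⟨
      rightSum f a (fromℕ (suc m) * d) (suc n)          ≤⟨ Refine.right-≤ f a b d 0≤d anti (suc n) (suc m) end ⟩
      rightSum f a d (suc n ℕ.* suc m)                  ≤⟨ a≤a+b (*-nonneg 0≤fa-fb 0≤d) ⟩
      rightSum f a d (suc n ℕ.* suc m) + (f a - f b) * d
                                                        ≡⟨ left-right-ab d (suc n ℕ.* suc m) end ⟨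
      leftSum f a d (suc n ℕ.* suc m)                   ≡⟨ cong (leftSum f a d) (ℕ.*-comm (suc n) (suc m)) ⟩
      leftSum f a d (suc m ℕ.* suc n)                   ≤⟨ Refine.left-≥ f a b d 0≤d anti (suc m) (suc n) end′ ⟩
      leftSum f a (fromℕ (suc n) * d) (suc m)           ≡⟨ cong (λ t → leftSum f a (fromℕ (suc n) * t) (suc m)) (swap (b - a) (u n) (u m)) ⟩
      leftSum f a (fromℕ (suc n) * (δ m * u n)) (suc m) ≡⟨ cong (λ t → leftSum f a t (suc m)) (fine n m) ⟩
      leftSum f a (δ m) (suc m)                         ≡⟨ left-right-ab (δ m) (suc m) (b-end m) ⟩
      rightSum f a (δ m) (suc m) + (f a - f b) * δ m    ≡⟨ cong (rightSum f a (δ m) (suc m) +_) (*-assoc (f a - f b) (b - a) (u m)) ⟨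
      riemannSum f a b m + C * u m                      ∎
      where
      open ≤-Reasoning
      d : ℚ
      d = δ n * u m
      0≤d : 0ℚ ≤ d
      0≤d = *-nonneg (0≤δ n) (0≤u m)
      swap : ∀ x y z → x * y * z ≡ x * z * y
      swap = solve-∀ ℚ-ring
      end : a + fromℕ (suc n ℕ.* suc m) * d ≡ b
      end = trans (cong (λ t → a + t * d) (fromℕ-* (suc n) (suc m)))
        (trans (cong (a +_) (*-assoc (fromℕ (suc n)) (fromℕ (suc m)) d))
        (trans (cong (λ t → a + fromℕ (suc n) * t) (fine m n)) (b-end n)))
      end′ : a + fromℕ (suc m ℕ.* suc n) * d ≡ b
      end′ = trans (cong (λ t → a + fromℕ t * d) (ℕ.*-comm (suc m) (suc n))) end

    riemann-cauchy : IsCauchy (riemannSum f a b)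
    riemann-cauchy ε 0<ε = N , λ m n N≤m N≤n → ∣∣-elim (_< ε) (close m n N≤n)
      (subst (_< ε) (sym (neg-- (R m) (R n))) (close n m N≤m))
      where
      small : ∃ λ N → ∀ n → N ℕ.≤ n → ∣ C * u n ∣ < ε
      small = null-scale C u u-null ε 0<ε
      N : ℕ
      N = proj₁ small
      open ≤-Reasoning
      R : ℕ → ℚ
      R = riemannSum f a b
      cancel : ∀ x y → x + y - x ≡ y
      cancel = solve-∀ ℚ-ring
      close : ∀ m n → N ℕ.≤ n → R m - R n < ε
      close m n N≤n = begin-strict
        R m - R n               ≤⟨ +-monoˡ-≤ (- R n) (compare m n) ⟩
        R n + C * u n - R n     ≡⟨ cancel (R n) (C * u n) ⟩
        C * u n                 ≤⟨ x≤∣x∣ (C * u n) ⟩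
        ∣ C * u n ∣             <⟨ proj₂ small n N≤n ⟩
        ε                       ∎

open RiemannSumLemmas

-- For antitone f every sequence of Riemann sums with mesh tending to 0
-- converges to the integral over [a, b], so equidistant partitions and
-- right endpoints suffice.
∫ : (f : ℚ → ℚ) (a b : ℚ) → a ≤ b → AntitoneOn f a b → ℝ
∫ f a b a≤b anti = lim (riemannSum f a b) (Integral.riemann-cauchy f a b a≤b anti)

-- x ↦ 1/x, extended by 0 at 0; only its values on [1, ∞) matter below.
recip : ℚ → ℚ
recip x with x ≟ 0ℚ
... | yes _   = 0ℚ
... | no  x≢0 = (1/ x) {{≢-nonZero x≢0}}

module RecipLemmas where

  recip-inverse : ∀ x → 0ℚ < x → recip x * x ≡ 1ℚ
  recip-inverse x 0<x with x ≟ 0ℚ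
  ... | yes refl = ⊥-elim (<-irrefl refl 0<x)
  ... | no  x≢0  = *-inverseˡ x {{≢-nonZero x≢0}}

  recip-nonneg : ∀ x → 0ℚ < x → 0ℚ ≤ recip x
  recip-nonneg x 0<x with x ≟ 0ℚ
  ... | yes _   = ≤-refl
  ... | no  x≢0 = <⇒≤ (positive⁻¹ ((1/ x) {{≢-nonZero x≢0}}) {{1/pos⇒pos x {{positive 0<x}}}})

  recip-antitone : ∀ b → AntitoneOn recip 1ℚ b
  recip-antitone b x y 1≤x x≤y _ = begin
    recip y                    ≡⟨ *-identityʳ (recip y) ⟨
    recip y * 1ℚ               ≡⟨ cong (recip y *_) (recip-inverse x 0<x) ⟨
    recip y * (recip x * x)    ≤⟨ *-monoˡ-≤-nonNeg (recip y) {{nonNegative (recip-nonneg y 0<y)}}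
                                    (*-monoˡ-≤-nonNeg (recip x) {{nonNegative (recip-nonneg x 0<x)}} x≤y) ⟩
    recip y * (recip x * y)    ≡⟨ eq (recip y) (recip x) y ⟩
    recip x * (recip y * y)    ≡⟨ cong (recip x *_) (recip-inverse y 0<y) ⟩
    recip x * 1ℚ               ≡⟨ *-identityʳ (recip x) ⟩
    recip x                    ∎
    where
    open ≤-Reasoning
    0<x : 0ℚ < x
    0<x = <-≤-trans 0<1 1≤x
    0<y : 0ℚ < y
    0<y = <-≤-trans 0<x x≤y
    eq : ∀ a b c → a * (b * c) ≡ b * (a * c)
    eq = solve-∀ ℚ-ring

open RecipLemmas

-- ln x = ∫₁ˣ dt/t for rational x ≥ 1.
ln : (x : ℚ) → {True (1ℚ ≤? x)} → ℝ
ln x {1≤x} = ∫ recip 1ℚ x (toWitness 1≤x) (recip-antitone x)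

{-# OPTIONS --safe #-}
module Submission where

-- In the letters A = dt/(1 − t) and B = dt/t, the shuffle product gives
--   Σ_{i ≤ m} (−1)ⁱ Aⁱ ⧢ A^{m−i} B Aᵏ = (−1)ᵐ B (Aᵐ ⧢ Aᵏ) = (−1)ᵐ C(m+k, k) B A^{m+k},
-- and the claim is its value at x = −1, where Aⁱ becomes (−ln 2)ⁱ / i!. The
-- identity is proved for formal power series: x d/dx is injective up to the
-- constant term and telescopes the sum. The series converge only conditionally
-- at −1, so products are evaluated there by Cesàro means, which for a Cauchy
-- product are convolutions of the two sequences of partial sums. Finally ln 2 is
-- tied to the alternating harmonic series by Catalan's identity
-- 1 − 1/2 + ⋯ − 1/(2n) = 1/(n+1) + ⋯ + 1/(2n), whose right side is a Riemann sum.
open import Defs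

module ShuffleAtMinusOne where

  open import Data.Integer.Base as ℤ using ()
  open import Data.List.Base using (List; []; _∷_; _++_)
  open import Data.Nat.Base as ℕ using (ℕ; zero; suc; s≤s; _!)
  open import Data.Nat.Combinatorics using (_C_; nCn≡1; nC1≡n; nCk+nC[k+1]≡[n+1]C[k+1])
  import Data.Nat.Properties as ℕ
  open import Data.Product.Base using (∃; _×_; _,_; proj₁; proj₂)
  open import Data.Rational.Base
  open import Data.Rational.Properties
  open import Level using (0ℓ)
  open import Relation.Binary.Bundles using (Setoid)
  open import Relation.Binary.PropositionalEquality
  open import Tactic.RingSolver using (solve-∀)
  open RationalLemmas
  open CauchyLemmas
  open UnitFractionLemmas
    using (u; 0≤u; 0≤fromℕ; fromℕ*u; fromℕ-+; fromℕ-*; unit-*; cesàro)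
  open PartialSumLemmas using (partialSum-cauchy)
  open RiemannSumLemmas using (sumℚ-cong; sumℚ-const; sumℚ-mono; sumℚ-split)
  open RecipLemmas using (recip-inverse)

  -- Finite sums

  sumℚ-cong-< : ∀ n (f g : ℕ → ℚ) → (∀ i → i ℕ.< n → f i ≡ g i) → sumℚ n f ≡ sumℚ n g
  sumℚ-cong-< zero    f g f≡g = refl
  sumℚ-cong-< (suc n) f g f≡g =
    cong₂ _+_ (sumℚ-cong-< n f g (λ i i<n → f≡g i (ℕ.m≤n⇒m≤1+n i<n))) (f≡g n ℕ.≤-refl)

  sumℚ-zero : ∀ n → sumℚ n (λ _ → 0ℚ) ≡ 0ℚ
  sumℚ-zero zero    = refl
  sumℚ-zero (suc n) = trans (+-identityʳ (sumℚ n (λ _ → 0ℚ))) (sumℚ-zero n)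

  sumℚ-+ : ∀ n f g → sumℚ n (λ i → f i + g i) ≡ sumℚ n f + sumℚ n g
  sumℚ-+ zero    f g = refl
  sumℚ-+ (suc n) f g = trans (cong (_+ (f n + g n)) (sumℚ-+ n f g)) (eq (sumℚ n f) (sumℚ n g) (f n) (g n))
    where
    eq : ∀ a b c d → a + b + (c + d) ≡ a + c + (b + d)
    eq = solve-∀ ℚ-ring

  sumℚ-* : ∀ n c f → sumℚ n (λ i → c * f i) ≡ c * sumℚ n f
  sumℚ-* zero    c f = sym (*-zeroʳ c)
  sumℚ-* (suc n) c f = trans (cong (_+ c * f n) (sumℚ-* n c f)) (sym (*-distribˡ-+ c (sumℚ n f) (f n)))

  sumℚ-first : ∀ n f → sumℚ (suc n) f ≡ f 0 + sumℚ n (λ i → f (suc i))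
  sumℚ-first n f = trans (sumℚ-split 1 n f) (cong (_+ sumℚ n (λ i → f (suc i))) (+-identityˡ (f 0)))

  sumℚ-reverse : ∀ n f → sumℚ (suc n) (λ i → f (n ℕ.∸ i)) ≡ sumℚ (suc n) f
  sumℚ-reverse zero    f = refl
  sumℚ-reverse (suc n) f = begin
    sumℚ (suc (suc n)) (λ i → f (suc n ℕ.∸ i))      ≡⟨ sumℚ-first (suc n) (λ i → f (suc n ℕ.∸ i)) ⟩
    f (suc n) + sumℚ (suc n) (λ i → f (n ℕ.∸ i))    ≡⟨ cong (f (suc n) +_) (sumℚ-reverse n f) ⟩
    f (suc n) + sumℚ (suc n) f                      ≡⟨ +-comm (f (suc n)) (sumℚ (suc n) f) ⟩
    sumℚ (suc n) f + f (suc n)                      ∎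
    where open ≡-Reasoning

  ∣sumℚ∣ : ∀ n f → ∣ sumℚ n f ∣ ≤ sumℚ n (λ i → ∣ f i ∣)
  ∣sumℚ∣ zero    f = ≤-refl
  ∣sumℚ∣ (suc n) f = ≤-trans (∣p+q∣≤∣p∣+∣q∣ (sumℚ n f) (f n)) (+-monoˡ-≤ ∣ f n ∣ (∣sumℚ∣ n f))

  -- Formal power series

  infixl 7 _⋆_

  -- The Cauchy product. It is applied both to coefficients of power series and to sequences of
  -- partial sums, where it yields Cesàro means.
  _⋆_ : (a b : ℕ → ℚ) → ℕ → ℚ
  (a ⋆ b) n = sumℚ (suc n) (λ i → a i * b (n ℕ.∸ i))

  ⋆-congˡ : ∀ a {b b′ : ℕ → ℚ} → (∀ n → b n ≡ b′ n) → ∀ n → (a ⋆ b) n ≡ (a ⋆ b′) n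
  ⋆-congˡ a b≡b′ n = sumℚ-cong (suc n) _ _ (λ i → cong (a i *_) (b≡b′ (n ℕ.∸ i)))

  ⋆-congʳ : ∀ b {a a′ : ℕ → ℚ} → (∀ n → a n ≡ a′ n) → ∀ n → (a ⋆ b) n ≡ (a′ ⋆ b) n
  ⋆-congʳ b a≡a′ n = sumℚ-cong (suc n) _ _ (λ i → cong (_* b (n ℕ.∸ i)) (a≡a′ i))

  ⋆-comm : ∀ a b n → (a ⋆ b) n ≡ (b ⋆ a) n
  ⋆-comm a b n = begin
    (a ⋆ b) n                                               ≡⟨ sumℚ-reverse n (λ i → a i * b (n ℕ.∸ i)) ⟨
    sumℚ (suc n) (λ i → a (n ℕ.∸ i) * b (n ℕ.∸ (n ℕ.∸ i)))  ≡⟨ sumℚ-cong-< (suc n) _ _ swap ⟩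
    (b ⋆ a) n                                               ∎
    where
    open ≡-Reasoning
    swap : ∀ i → i ℕ.< suc n → a (n ℕ.∸ i) * b (n ℕ.∸ (n ℕ.∸ i)) ≡ b i * a (n ℕ.∸ i)
    swap i (s≤s i≤n) = trans (cong (λ t → a (n ℕ.∸ i) * b t) (ℕ.m∸[m∸n]≡n i≤n)) (*-comm (a (n ℕ.∸ i)) (b i))

  ⋆-shift : ∀ a b n → (a ⋆ b) (suc n) ≡ a 0 * b (suc n) + ((λ i → a (suc i)) ⋆ b) n
  ⋆-shift a b n = sumℚ-first (suc n) (λ i → a i * b (suc n ℕ.∸ i))

  -- a n ↦ n a n is the derivation x d/dx.
  leibniz : ∀ a b n → fromℕ n * (a ⋆ b) n ≡ ((λ i → fromℕ i * a i) ⋆ b) n + (a ⋆ (λ i → fromℕ i * b i)) n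
  leibniz a b n = begin
    fromℕ n * (a ⋆ b) n
      ≡⟨ sumℚ-* (suc n) (fromℕ n) (λ i → a i * b (n ℕ.∸ i)) ⟨
    sumℚ (suc n) (λ i → fromℕ n * (a i * b (n ℕ.∸ i)))
      ≡⟨ sumℚ-cong-< (suc n) _ _ split ⟩
    sumℚ (suc n) (λ i → fromℕ i * a i * b (n ℕ.∸ i) + a i * (fromℕ (n ℕ.∸ i) * b (n ℕ.∸ i)))
      ≡⟨ sumℚ-+ (suc n) (λ i → fromℕ i * a i * b (n ℕ.∸ i)) (λ i → a i * (fromℕ (n ℕ.∸ i) * b (n ℕ.∸ i))) ⟩
    ((λ i → fromℕ i * a i) ⋆ b) n + (a ⋆ (λ i → fromℕ i * b i)) n ∎
    where
    open ≡-Reasoning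
    eq : ∀ i j a b → (i + j) * (a * b) ≡ i * a * b + a * (j * b)
    eq = solve-∀ ℚ-ring
    split : ∀ i → i ℕ.< suc n →
      fromℕ n * (a i * b (n ℕ.∸ i)) ≡ fromℕ i * a i * b (n ℕ.∸ i) + a i * (fromℕ (n ℕ.∸ i) * b (n ℕ.∸ i))
    split i (s≤s i≤n) = trans
      (cong (_* (a i * b (n ℕ.∸ i))) (trans (cong fromℕ (sym (ℕ.m+[n∸m]≡n i≤n))) (fromℕ-+ i (n ℕ.∸ i))))
      (eq (fromℕ i) (fromℕ (n ℕ.∸ i)) (a i) (b (n ℕ.∸ i)))

  -- Taking partial sums is multiplication by 1/(1 - x), which can be absorbed into the first
  -- factor.
  partialSums-⋆ : ∀ a b n → sumℚ (suc n) (a ⋆ b) ≡ ((λ i → sumℚ (suc i) a) ⋆ b) n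
  partialSums-⋆ a b zero    = eq (a 0) (b 0)
    where
    eq : ∀ x y → 0ℚ + (0ℚ + x * y) ≡ 0ℚ + (0ℚ + x) * y
    eq = solve-∀ ℚ-ring
  partialSums-⋆ a b (suc n) = begin
    sumℚ (suc n) (a ⋆ b) + (a ⋆ b) (suc n)
      ≡⟨ cong₂ _+_ (partialSums-⋆ a b n) (⋆-shift a b n) ⟩
    (A ⋆ b) n + (a 0 * b (suc n) + ((λ i → a (suc i)) ⋆ b) n)
      ≡⟨ eq ((A ⋆ b) n) (a 0) (b (suc n)) (((λ i → a (suc i)) ⋆ b) n) ⟩
    (0ℚ + a 0) * b (suc n) + ((A ⋆ b) n + ((λ i → a (suc i)) ⋆ b) n)
      ≡⟨ cong ((0ℚ + a 0) * b (suc n) +_)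
           (sumℚ-+ (suc n) (λ i → A i * b (n ℕ.∸ i)) (λ i → a (suc i) * b (n ℕ.∸ i))) ⟨
    (0ℚ + a 0) * b (suc n) + sumℚ (suc n) (λ i → A i * b (n ℕ.∸ i) + a (suc i) * b (n ℕ.∸ i))
      ≡⟨ cong ((0ℚ + a 0) * b (suc n) +_)
           (sumℚ-cong (suc n) _ _ (λ i → *-distribʳ-+ (b (n ℕ.∸ i)) (A i) (a (suc i)))) ⟨
    A 0 * b (suc n) + ((λ i → A (suc i)) ⋆ b) n
      ≡⟨ ⋆-shift A b n ⟨
    (A ⋆ b) (suc n) ∎
    where
    open ≡-Reasoning
    A : ℕ → ℚ
    A i = sumℚ (suc i) a
    eq : ∀ x y z w → x + (y * z + w) ≡ (0ℚ + y) * z + (x + w)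
    eq = solve-∀ ℚ-ring

  -- Multiplication by x / (1 − x).
  Prefix : (ℕ → ℚ) → ℕ → ℚ
  Prefix a n = sumℚ n a

  Prefix-⋆ : ∀ a b n → (Prefix a ⋆ b) n ≡ Prefix (a ⋆ b) n
  Prefix-⋆ a b zero    = eq (b 0)
    where
    eq : ∀ x → 0ℚ + 0ℚ * x ≡ 0ℚ
    eq = solve-∀ ℚ-ring
  Prefix-⋆ a b (suc n) = begin
    (Prefix a ⋆ b) (suc n)                              ≡⟨ ⋆-shift (Prefix a) b n ⟩
    0ℚ * b (suc n) + ((λ i → sumℚ (suc i) a) ⋆ b) n     ≡⟨ cong₂ _+_ (*-zeroˡ (b (suc n))) (sym (partialSums-⋆ a b n)) ⟩
    0ℚ + sumℚ (suc n) (a ⋆ b)                           ≡⟨ +-identityˡ (sumℚ (suc n) (a ⋆ b)) ⟩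
    Prefix (a ⋆ b) (suc n)                              ∎
    where open ≡-Reasoning

  ⋆-Prefix : ∀ a b n → (a ⋆ Prefix b) n ≡ Prefix (a ⋆ b) n
  ⋆-Prefix a b n = trans (⋆-comm a (Prefix b) n)
    (trans (Prefix-⋆ b a n) (sumℚ-cong n _ _ (⋆-comm b a)))

  -- Two rounds of partial sums multiply by 1/(1 - x)², and each factor of the product takes one
  -- 1/(1 - x). This is what turns the Cesàro mean of a Cauchy product into a convolution of partial
  -- sums.
  partialSums² : ∀ a b n →
    sumℚ (suc n) (λ i → sumℚ (suc i) (a ⋆ b)) ≡ ((λ i → sumℚ (suc i) a) ⋆ (λ i → sumℚ (suc i) b)) n
  partialSums² a b n = begin
    sumℚ (suc n) (λ i → sumℚ (suc i) (a ⋆ b))   ≡⟨ sumℚ-cong (suc n) _ _ (λ i → trans (partialSums-⋆ a b i) (⋆-comm A b i)) ⟩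
    sumℚ (suc n) (b ⋆ A)                        ≡⟨ partialSums-⋆ b A n ⟩
    ((λ i → sumℚ (suc i) b) ⋆ A) n              ≡⟨ ⋆-comm (λ i → sumℚ (suc i) b) A n ⟩
    (A ⋆ (λ i → sumℚ (suc i) b)) n              ∎
    where
    open ≡-Reasoning
    A : ℕ → ℚ
    A i = sumℚ (suc i) a

  fromℕ*-cancel : ∀ n {x y} → fromℕ (suc n) * x ≡ fromℕ (suc n) * y → x ≡ y
  fromℕ*-cancel n {x} {y} nx≡ny = begin
    x                          ≡⟨ undo x ⟨
    u n * (fromℕ (suc n) * x)  ≡⟨ cong (u n *_) nx≡ny ⟩
    u n * (fromℕ (suc n) * y)  ≡⟨ undo y ⟩
    y                          ∎
    where
    open ≡-Reasoning
    eq : ∀ a b c → a * (b * c) ≡ b * a * c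
    eq = solve-∀ ℚ-ring
    undo : ∀ z → u n * (fromℕ (suc n) * z) ≡ z
    undo z = trans (eq (u n) (fromℕ (suc n)) z) (trans (cong (_* z) (fromℕ*u n)) (*-identityˡ z))

  -- In every positive degree x d/dx multiplies by a nonzero number, so only the constant term is
  -- lost. All identities between series below are proved by differentiating and applying this.
  euler-unique : ∀ (a b : ℕ → ℚ) → a 0 ≡ b 0 → (∀ n → fromℕ n * a n ≡ fromℕ n * b n) → ∀ n → a n ≡ b n
  euler-unique a b a₀≡b₀ θa≡θb zero    = a₀≡b₀
  euler-unique a b a₀≡b₀ θa≡θb (suc n) = fromℕ*-cancel n (θa≡θb (suc n))

  -- Multiple polylogarithms as formal power series

  -- The coefficients of the multiple polylogarithm Li_s(x).
  coeff : List Entry → ℕ → ℚ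
  coeff []      zero    = 1ℚ
  coeff []      (suc n) = 0ℚ
  coeff (e ∷ s) zero    = 0ℚ
  coeff (e ∷ s) (suc n) = factor e (suc n) * partialSum s n

  -- The terms with largest index k₁ = n make up the coefficient of xⁿ, so truncating the series at
  -- degree n and setting x = 1 truncates the nested sum at k₁ ≤ n.
  sum-coeff : ∀ s n → sumℚ (suc n) (coeff s) ≡ partialSum s n
  sum-coeff []      zero    = refl
  sum-coeff []      (suc n) = trans (+-identityʳ (sumℚ (suc n) (coeff []))) (sum-coeff [] n)
  sum-coeff (e ∷ s) zero    = refl
  sum-coeff (e ∷ s) (suc n) = cong (_+ factor e (suc n) * partialSum s n) (sum-coeff (e ∷ s) n)

  -- The exponent of x is the first index k₁ alone, so x = -1 puts a bar on the first entry and on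
  -- no other.
  coeff-bar : ∀ t s → .{{_ : ℕ.NonZero t}} → ∀ n → -1^ n * coeff (plain t ∷ s) n ≡ coeff (bar t ∷ s) n
  coeff-bar t s zero    = refl
  coeff-bar t s (suc n) = sym (*-assoc (-1^ suc n) (unitFraction^ t (suc n)) (partialSum s n))

  unitFraction¹ : ∀ n → unitFraction^ 1 (suc n) ≡ u n
  unitFraction¹ n = /-cong {p₁ = ℤ.+ 1} {q₁ = suc n ℕ.^ 1} {p₂ = ℤ.+ 1} {q₂ = suc n}
    {{ℕ.m^n≢0 (suc n) 1}} refl (ℕ.*-identityʳ (suc n))

  unitFraction² : ∀ n → unitFraction^ 2 (suc n) ≡ u n * u n
  unitFraction² n = trans
    (/-cong {p₁ = ℤ.+ 1} {q₁ = suc n ℕ.^ 2} {p₂ = ℤ.+ 1} {q₂ = suc n ℕ.* suc n}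
      {{ℕ.m^n≢0 (suc n) 2}} refl (cong (suc n ℕ.*_) (ℕ.*-identityʳ (suc n))))
    (unit-* n)

  -- The factor n cancels 1/n and leaves a partial sum: x d/dx strips a leading letter A at the cost
  -- of the factor x/(1 - x).
  euler-1 : ∀ s n → fromℕ n * coeff (plain 1 ∷ s) n ≡ Prefix (coeff s) n
  euler-1 s zero    = refl
  euler-1 s (suc n) = begin
    fromℕ (suc n) * (unitFraction^ 1 (suc n) * partialSum s n)   ≡⟨ cong (λ t → fromℕ (suc n) * (t * partialSum s n)) (unitFraction¹ n) ⟩
    fromℕ (suc n) * (u n * partialSum s n)                       ≡⟨ *-assoc (fromℕ (suc n)) (u n) (partialSum s n) ⟨
    fromℕ (suc n) * u n * partialSum s n                         ≡⟨ cong (_* partialSum s n) (fromℕ*u n) ⟩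
    1ℚ * partialSum s n                                          ≡⟨ *-identityˡ (partialSum s n) ⟩
    partialSum s n                                               ≡⟨ sum-coeff s n ⟨
    Prefix (coeff s) (suc n)                                     ∎
    where open ≡-Reasoning

  -- An entry 2 is the pair of letters BA; x d/dx strips the B without any factor.
  euler-2 : ∀ s n → fromℕ n * coeff (plain 2 ∷ s) n ≡ coeff (plain 1 ∷ s) n
  euler-2 s zero    = refl
  euler-2 s (suc n) = begin
    fromℕ (suc n) * (unitFraction^ 2 (suc n) * partialSum s n)   ≡⟨ cong (λ t → fromℕ (suc n) * (t * partialSum s n)) (unitFraction² n) ⟩
    fromℕ (suc n) * (u n * u n * partialSum s n)                 ≡⟨ eq (fromℕ (suc n)) (u n) (partialSum s n) ⟩
    fromℕ (suc n) * u n * (u n * partialSum s n)                 ≡⟨ cong (_* (u n * partialSum s n)) (fromℕ*u n) ⟩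
    1ℚ * (u n * partialSum s n)                                  ≡⟨ *-identityˡ (u n * partialSum s n) ⟩
    u n * partialSum s n                                         ≡⟨ cong (_* partialSum s n) (unitFraction¹ n) ⟨
    unitFraction^ 1 (suc n) * partialSum s n                     ∎
    where
    open ≡-Reasoning
    eq : ∀ a b c → a * (b * b * c) ≡ a * b * (b * c)
    eq = solve-∀ ℚ-ring

  ⋆-identityˡ : ∀ a n → (coeff [] ⋆ a) n ≡ a n
  ⋆-identityˡ a n = begin
    (coeff [] ⋆ a) n
      ≡⟨ sumℚ-first n (λ i → coeff [] i * a (n ℕ.∸ i)) ⟩
    1ℚ * a n + sumℚ n (λ i → 0ℚ * a (n ℕ.∸ suc i))
      ≡⟨ cong₂ _+_ (*-identityˡ (a n)) (trans (sumℚ-cong n _ _ (λ i → *-zeroˡ (a (n ℕ.∸ suc i)))) (sumℚ-zero n)) ⟩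
    a n + 0ℚ
      ≡⟨ +-identityʳ (a n) ⟩
    a n ∎
    where open ≡-Reasoning

  ⋆-at-0 : ∀ a b → a 0 ≡ 0ℚ → (a ⋆ b) 0 ≡ 0ℚ
  ⋆-at-0 a b a₀≡0 = trans (cong (λ t → 0ℚ + t * b 0) a₀≡0) (eq (b 0))
    where
    eq : ∀ x → 0ℚ + 0ℚ * x ≡ 0ℚ
    eq = solve-∀ ℚ-ring

  -- P i = (−ln (1 − x))ⁱ / i!
  P : ℕ → ℕ → ℚ
  P i = coeff (ones i)

  -- The Leibniz rule is the recursion of the shuffle product on first letters: the leading A comes
  -- from the left or from the right factor, and x/(1 - x) is pulled out of both terms.
  euler-⋆-11 : ∀ s t n → fromℕ n * (coeff (plain 1 ∷ s) ⋆ coeff (plain 1 ∷ t)) n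
    ≡ Prefix (coeff s ⋆ coeff (plain 1 ∷ t)) n + Prefix (coeff (plain 1 ∷ s) ⋆ coeff t) n
  euler-⋆-11 s t n = trans (leibniz (coeff (plain 1 ∷ s)) (coeff (plain 1 ∷ t)) n)
    (cong₂ _+_
      (trans (⋆-congʳ (coeff (plain 1 ∷ t)) (euler-1 s) n) (Prefix-⋆ (coeff s) (coeff (plain 1 ∷ t)) n))
      (trans (⋆-congˡ (coeff (plain 1 ∷ s)) (euler-1 t) n) (⋆-Prefix (coeff (plain 1 ∷ s)) (coeff t) n)))

  euler-⋆-12 : ∀ s t n → fromℕ n * (coeff (plain 1 ∷ s) ⋆ coeff (plain 2 ∷ t)) n
    ≡ Prefix (coeff s ⋆ coeff (plain 2 ∷ t)) n + (coeff (plain 1 ∷ s) ⋆ coeff (plain 1 ∷ t)) n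
  euler-⋆-12 s t n = trans (leibniz (coeff (plain 1 ∷ s)) (coeff (plain 2 ∷ t)) n)
    (cong₂ _+_
      (trans (⋆-congʳ (coeff (plain 2 ∷ t)) (euler-1 s) n) (Prefix-⋆ (coeff s) (coeff (plain 2 ∷ t)) n))
      (⋆-congˡ (coeff (plain 1 ∷ s)) (euler-2 t) n))

  -- The shuffle of Aᵐ with Aᵏ. Differentiating lowers m or k by one, and the two resulting binomial
  -- coefficients add up by Pascal's rule. Both recursive calls have the same total degree, so `N`
  -- is an argument of its own and the recursion runs on it.
  P-⋆-P : ∀ m k N → m ℕ.+ k ≡ N → ∀ n → (P m ⋆ P k) n ≡ fromℕ (N C k) * P N n
  P-⋆-P zero k N refl n = begin
    (P 0 ⋆ P k) n            ≡⟨ ⋆-identityˡ (P k) n ⟩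
    P k n                    ≡⟨ *-identityˡ (P k n) ⟨
    1ℚ * P k n               ≡⟨ cong (λ t → fromℕ t * P k n) (nCn≡1 k) ⟨
    fromℕ (k C k) * P k n    ∎
    where open ≡-Reasoning
  P-⋆-P (suc m) zero N refl n = begin
    (P (suc m) ⋆ P 0) n      ≡⟨ ⋆-comm (P (suc m)) (P 0) n ⟩
    (P 0 ⋆ P (suc m)) n      ≡⟨ ⋆-identityˡ (P (suc m)) n ⟩
    P (suc m) n              ≡⟨ *-identityˡ (P (suc m) n) ⟨
    1ℚ * P (suc m) n         ≡⟨ cong (λ t → 1ℚ * P t n) (ℕ.+-identityʳ (suc m)) ⟨
    1ℚ * P (suc m ℕ.+ 0) n   ∎
    where open ≡-Reasoning
  P-⋆-P (suc m) (suc k) (suc N) m+k≡N =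
    euler-unique (P (suc m) ⋆ P (suc k)) (λ n → c * P (suc N) n)
      (trans (⋆-at-0 (P (suc m)) (P (suc k)) refl) (sym (*-zeroʳ c))) derivative
    where
    open ≡-Reasoning
    c : ℚ
    c = fromℕ (suc N C suc k)
    eq : ∀ x y z → x * z + y * z ≡ (y + x) * z
    eq = solve-∀ ℚ-ring
    eq′ : ∀ x y z → x * (y * z) ≡ y * (x * z)
    eq′ = solve-∀ ℚ-ring
    scale : ∀ i j → i ℕ.+ j ≡ N → ∀ n → Prefix (P i ⋆ P j) n ≡ fromℕ (N C j) * Prefix (P N) n
    scale i j i+j≡N n = trans (sumℚ-cong n _ _ (P-⋆-P i j N i+j≡N)) (sumℚ-* n (fromℕ (N C j)) (P N))
    derivative : ∀ n → fromℕ n * (P (suc m) ⋆ P (suc k)) n ≡ fromℕ n * (c * P (suc N) n)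
    derivative n = begin
      fromℕ n * (P (suc m) ⋆ P (suc k)) n
        ≡⟨ euler-⋆-11 (ones m) (ones k) n ⟩
      Prefix (P m ⋆ P (suc k)) n + Prefix (P (suc m) ⋆ P k) n
        ≡⟨ cong₂ _+_ (scale m (suc k) (ℕ.suc-injective m+k≡N) n)
             (scale (suc m) k (trans (sym (ℕ.+-suc m k)) (ℕ.suc-injective m+k≡N)) n) ⟩
      fromℕ (N C suc k) * Prefix (P N) n + fromℕ (N C k) * Prefix (P N) n
        ≡⟨ eq (fromℕ (N C suc k)) (fromℕ (N C k)) (Prefix (P N) n) ⟩
      (fromℕ (N C k) + fromℕ (N C suc k)) * Prefix (P N) n
        ≡⟨ cong (_* Prefix (P N) n) (fromℕ-+ (N C k) (N C suc k)) ⟨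
      fromℕ (N C k ℕ.+ N C suc k) * Prefix (P N) n
        ≡⟨ cong (λ t → fromℕ t * Prefix (P N) n) (nCk+nC[k+1]≡[n+1]C[k+1] N k) ⟩
      c * Prefix (P N) n
        ≡⟨ cong (c *_) (euler-1 (ones N) n) ⟨
      c * (fromℕ n * P (suc N) n)
        ≡⟨ eq′ c (fromℕ n) (P (suc N) n) ⟩
      fromℕ n * (c * P (suc N) n) ∎

  -- The alternating shuffle sum and its telescoping derivative

  module Alternating (k : ℕ) where

    -- The series of the word Aʲ B Aᵏ⁺¹: the entry 2 already contains one A, so this `k` is one less
    -- than the k of the theorem.
    F : ℕ → ℕ → ℚ
    F j = coeff (ones j ++ plain 2 ∷ ones k)

    -- The upper limit is independent of the degree `n`, because the telescoping concerns the
    -- truncated sums. The term of index 0 is `F n` itself, as `P 0` is the series 1.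
    alternatingSum : ℕ → ℕ → ℕ → ℚ
    alternatingSum n zero    l = F n l
    alternatingSum n (suc i) l = alternatingSum n i l + -1^ suc i * (P (suc i) ⋆ F (n ℕ.∸ suc i)) l

    F-at-0 : ∀ j → F j 0 ≡ 0ℚ
    F-at-0 zero    = refl
    F-at-0 (suc j) = refl

    alternatingSum-at-0 : ∀ n i → alternatingSum n i 0 ≡ 0ℚ
    alternatingSum-at-0 n zero    = F-at-0 n
    alternatingSum-at-0 n (suc i) = trans
      (cong₂ (λ x y → x + -1^ suc i * y) (alternatingSum-at-0 n i) (⋆-at-0 (P (suc i)) (F (n ℕ.∸ suc i)) refl))
      (eq (-1^ suc i))
      where
      eq : ∀ x → 0ℚ + x * 0ℚ ≡ 0ℚ
      eq = solve-∀ ℚ-ring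

    -- Here `a` is the sum so far and `f` the next product. The part `p` of the derivative of `f` is
    -- what the derivative of `a` has left over; the sign change cancels it and only `w` survives.
    telescope-step : ∀ n s a p f w → n * a ≡ s * p → n * f ≡ p + w → n * (a + - s * f) ≡ - s * w
    telescope-step n s a p f w na nf = begin
      n * (a + - s * f)        ≡⟨ eq n s a f ⟩
      n * a + - s * (n * f)    ≡⟨ cong₂ (λ x y → x + - s * y) na nf ⟩
      s * p + - s * (p + w)    ≡⟨ eq′ s p w ⟩
      - s * w                  ∎
      where
      open ≡-Reasoning
      eq : ∀ n s a f → n * (a + - s * f) ≡ n * a + - s * (n * f)
      eq = solve-∀ ℚ-ring
      eq′ : ∀ s p w → s * p + - s * (p + w) ≡ - s * w
      eq′ = solve-∀ ℚ-ring

    -- Each product contributes two terms, one per stripped letter, and the term that strips the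
    -- left factor cancels against the previous product. The bound i < n ensures that `F` still
    -- begins with an A in every product involved.
    telescoped : ∀ n i → i ℕ.< n → ∀ l →
      fromℕ l * alternatingSum n i l ≡ -1^ i * Prefix (P i ⋆ F (n ℕ.∸ suc i)) l
    telescoped (suc n) zero    _ l = begin
      fromℕ l * F (suc n) l          ≡⟨ euler-1 (ones n ++ plain 2 ∷ ones k) l ⟩
      Prefix (F n) l                 ≡⟨ sumℚ-cong l _ _ (⋆-identityˡ (F n)) ⟨
      Prefix (P 0 ⋆ F n) l           ≡⟨ *-identityˡ (Prefix (P 0 ⋆ F n) l) ⟨
      1ℚ * Prefix (P 0 ⋆ F n) l      ∎
      where open ≡-Reasoning
    telescoped (suc n) (suc i) (s≤s i<n) l = telescope-step (fromℕ l) (-1^ i) (alternatingSum (suc n) i l)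
      (Prefix (P i ⋆ F (n ℕ.∸ i)) l) _ _
      (telescoped (suc n) i (ℕ.m≤n⇒m≤1+n i<n) l)
      -- The index must be exhibited as a successor before the list behind `F` shows its leading
      -- entry 1.
      (subst (λ j → fromℕ l * (P (suc i) ⋆ F j) l
                    ≡ Prefix (P i ⋆ F j) l + Prefix (P (suc i) ⋆ F (n ℕ.∸ suc i)) l)
        (sym n∸i≡) (euler-⋆-11 (ones i) (ones (n ℕ.∸ suc i) ++ plain 2 ∷ ones k) l))
      where
      n∸i≡ : n ℕ.∸ i ≡ suc (n ℕ.∸ suc i)
      n∸i≡ = ℕ.+-∸-assoc 1 i<n

    -- In the last product `F 0` begins with B, so stripping that letter leaves Aᵐ⁺¹ shuffled with
    -- Aᵏ⁺¹ and no factor x/(1 - x). `P-⋆-P` evaluates this shuffle, and the result is the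
    -- derivative of a multiple of the series of B Aᴺ with N = m + k + 2.
    shuffle : ∀ m l → alternatingSum (suc m) (suc m) l
      ≡ -1^ suc m * fromℕ ((suc m ℕ.+ suc k) C suc k) * coeff (plain 2 ∷ ones (m ℕ.+ suc k)) l
    shuffle m = euler-unique (alternatingSum (suc m) (suc m)) (λ l → s * c * G l)
      (trans (alternatingSum-at-0 (suc m) (suc m)) (sym (*-zeroʳ (s * c)))) derivative
      where
      open ≡-Reasoning
      s c : ℚ
      s = -1^ suc m
      c = fromℕ ((suc m ℕ.+ suc k) C suc k)
      G : ℕ → ℚ
      G = coeff (plain 2 ∷ ones (m ℕ.+ suc k))
      eq : ∀ s c n g → s * (c * (n * g)) ≡ n * (s * c * g)
      eq = solve-∀ ℚ-ring
      derivative : ∀ l → fromℕ l * alternatingSum (suc m) (suc m) l ≡ fromℕ l * (s * c * G l)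
      derivative l = begin
        fromℕ l * alternatingSum (suc m) (suc m) l
          ≡⟨ telescope-step (fromℕ l) (-1^ m) (alternatingSum (suc m) m l) (Prefix (P m ⋆ F (m ℕ.∸ m)) l) _ _
               (telescoped (suc m) m ℕ.≤-refl l)
               (subst (λ j → fromℕ l * (P (suc m) ⋆ F j) l
                             ≡ Prefix (P m ⋆ F j) l + (P (suc m) ⋆ P (suc k)) l)
                 (sym (ℕ.n∸n≡0 m)) (euler-⋆-12 (ones m) (ones k) l)) ⟩
        s * (P (suc m) ⋆ P (suc k)) l
          ≡⟨ cong (s *_) (P-⋆-P (suc m) (suc k) (suc m ℕ.+ suc k) refl l) ⟩
        s * (c * P (suc m ℕ.+ suc k) l)
          ≡⟨ cong (λ t → s * (c * t)) (euler-2 (ones (m ℕ.+ suc k)) l) ⟨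
        s * (c * (fromℕ l * G l))
          ≡⟨ eq s c (fromℕ l) (G l) ⟩
        fromℕ l * (s * c * G l) ∎

  -- Equality of real numbers

  null-cong : ∀ (x y : ℕ → ℚ) → (∀ n → x n ≡ y n) → IsNull y → IsNull x
  null-cong x y x≡y = null-≤ x y (λ n → ≤-reflexive (cong ∣_∣ (x≡y n)))

  null-*-bounded : ∀ (x y : ℕ → ℚ) B → (∀ n → ∣ y n ∣ ≤ B) → IsNull x → IsNull (λ n → x n * y n)
  null-*-bounded x y B y≤B nx = null-≤ (λ n → x n * y n) (λ n → B * x n) below (null-scale B x nx)
    where
    open ≤-Reasoning
    below : ∀ n → ∣ x n * y n ∣ ≤ ∣ B * x n ∣
    below n = begin
      ∣ x n * y n ∣        ≡⟨ ∣p*q∣≡∣p∣*∣q∣ (x n) (y n) ⟩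
      ∣ x n ∣ * ∣ y n ∣    ≤⟨ *-monoˡ-≤-nonNeg ∣ x n ∣ {{∣-∣-nonNeg (x n)}} (≤-trans (y≤B n) (x≤∣x∣ B)) ⟩
      ∣ x n ∣ * ∣ B ∣      ≡⟨ *-comm ∣ x n ∣ ∣ B ∣ ⟩
      ∣ B ∣ * ∣ x n ∣      ≡⟨ ∣p*q∣≡∣p∣*∣q∣ B (x n) ⟨
      ∣ B * x n ∣          ∎

  cauchy-subsequence : ∀ x (g : ℕ → ℕ) → (∀ n → n ℕ.≤ g n) → IsCauchy x → IsNull (λ n → x (g n) - x n)
  cauchy-subsequence x g n≤g cx ε 0<ε with cx ε 0<ε
  ... | N , close = N , λ n N≤n → close (g n) n (ℕ.≤-trans N≤n (n≤g n)) N≤n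

  infix 4 _≋_

  -- A record, so that both sides can be inferred from a proof.
  record _≋_ (x y : ℝ) : Set where
    constructor equal
    field
      equality : x ≃ᵣ y

  open _≋_ public

  pointwise : ∀ {x y} → (∀ n → approx x n ≡ approx y n) → x ≋ y
  pointwise {x} {y} x≡y = equal (null-cong _ (λ _ → 0ℚ)
    (λ n → trans (cong (_- approx y n) (x≡y n)) (+-inverseʳ (approx y n)))
    (λ ε 0<ε → 0 , λ _ _ → 0<ε))

  ≋-refl : ∀ {x} → x ≋ x
  ≋-refl = pointwise (λ _ → refl)

  ≋-sym : ∀ {x y} → x ≋ y → y ≋ x
  ≋-sym {x} {y} (equal p) = equal (null-≤ _ _ (λ n → ≤-reflexive
    (trans (cong ∣_∣ (sym (neg-- (approx x n) (approx y n)))) (∣-p∣≡∣p∣ (approx x n - approx y n)))) p)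

  ≋-trans : ∀ {x y z} → x ≋ y → y ≋ z → x ≋ z
  ≋-trans {x} {y} {z} (equal p) (equal q) =
    equal (null-cong _ _ (λ n → eq (approx x n) (approx y n) (approx z n)) (null-+ _ _ p q))
    where
    eq : ∀ a b c → a - c ≡ (a - b) + (b - c)
    eq = solve-∀ ℚ-ring

  ≋-setoid : Setoid 0ℓ 0ℓ
  ≋-setoid = record
    { Carrier = ℝ ; _≈_ = _≋_
    ; isEquivalence = record { refl = ≋-refl ; sym = ≋-sym ; trans = ≋-trans } }

  +ᵣ-cong : ∀ {x x′ y y′} → x ≋ x′ → y ≋ y′ → x +ᵣ y ≋ x′ +ᵣ y′
  +ᵣ-cong {x} {x′} {y} {y′} (equal p) (equal q) =
    equal (null-cong _ _ (λ n → eq (approx x n) (approx x′ n) (approx y n) (approx y′ n)) (null-+ _ _ p q))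
    where
    eq : ∀ a b c d → a + c - (b + d) ≡ (a - b) + (c - d)
    eq = solve-∀ ℚ-ring

  *ᵣ-cong : ∀ {x x′ y y′} → x ≋ x′ → y ≋ y′ → x *ᵣ y ≋ x′ *ᵣ y′
  *ᵣ-cong {x} {x′} {y} {y′} (equal p) (equal q) =
    equal (null-cong _ _ (λ n → eq (approx x n) (approx x′ n) (approx y n) (approx y′ n))
      (null-+ _ _
        (null-*-bounded _ (approx y) (proj₁ K) (proj₂ (proj₂ K)) p)
        (null-*-bounded _ (approx x′) (proj₁ K′) (proj₂ (proj₂ K′)) q)))
    where
    K : ∃ λ b → 0ℚ < b × (∀ n → ∣ approx y n ∣ ≤ b)
    K = bounded (approx y) (cauchy y)
    K′ : ∃ λ c → 0ℚ < c × (∀ n → ∣ approx x′ n ∣ ≤ c)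
    K′ = bounded (approx x′) (cauchy x′)
    eq : ∀ a b c d → a * c - b * d ≡ (a - b) * c + (c - d) * b
    eq = solve-∀ ℚ-ring

  sum₁-cong : ∀ n {f g : ℕ → ℝ} → (∀ i → i ℕ.≤ n → f i ≋ g i) → sum₁ n f ≋ sum₁ n g
  sum₁-cong zero    f≋g = ≋-refl
  sum₁-cong (suc n) f≋g = +ᵣ-cong (sum₁-cong n (λ i i≤n → f≋g i (ℕ.m≤n⇒m≤1+n i≤n))) (f≋g (suc n) ℕ.≤-refl)

  -- The last term of the sum is split off and subtracted first: it becomes the separate term with
  -- (ln 2)ᵐ / m!.
  rearrange : ∀ x y f i → x +ᵣ sum₁ (suc i) f ≋ y → x ≋ y -ᵣ f (suc i) -ᵣ sum₁ i f
  rearrange x y f i (equal q) = equal (null-cong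
    (λ n → approx x n - (approx y n - approx (f (suc i)) n - approx (sum₁ i f) n))
    (λ n → approx x n + (approx (sum₁ i f) n + approx (f (suc i)) n) - approx y n)
    (λ n → eq (approx x n) (approx y n) (approx (sum₁ i f) n) (approx (f (suc i)) n)) q)
    where
    eq : ∀ x y s t → x - (y - t - s) ≡ x + (s + t) - y
    eq = solve-∀ ℚ-ring

  sum₁-pointwise : ∀ m f g l → (∀ i → i ℕ.≤ m → approx (f i) l ≡ approx (g i) l) →
                   approx (sum₁ m f) l ≡ approx (sum₁ m g) l
  sum₁-pointwise zero    f g l f≡g = refl
  sum₁-pointwise (suc m) f g l f≡g = cong₂ _+_
    (sum₁-pointwise m f g l (λ i i≤m → f≡g i (ℕ.m≤n⇒m≤1+n i≤m))) (f≡g (suc m) ℕ.≤-refl)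

  -- Cesàro means

  mean : (ℕ → ℚ) → ℕ → ℚ
  mean x n = u n * sumℚ (suc n) x

  mean-cong : ∀ n (f g : ℕ → ℚ) → (∀ i → f i ≡ g i) → mean f n ≡ mean g n
  mean-cong n f g f≡g = cong (u n *_) (sumℚ-cong (suc n) f g f≡g)

  mean-mono : ∀ n (f g : ℕ → ℚ) → (∀ i → i ℕ.< suc n → f i ≤ g i) → mean f n ≤ mean g n
  mean-mono n f g f≤g = *-monoˡ-≤-nonNeg (u n) {{nonNegative (0≤u n)}} (sumℚ-mono (suc n) f g f≤g)

  mean-+ : ∀ n f g → mean (λ i → f i + g i) n ≡ mean f n + mean g n
  mean-+ n f g = trans (cong (u n *_) (sumℚ-+ (suc n) f g)) (*-distribˡ-+ (u n) (sumℚ (suc n) f) (sumℚ (suc n) g))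

  mean-* : ∀ n c f → mean (λ i → c * f i) n ≡ c * mean f n
  mean-* n c f = trans (cong (u n *_) (sumℚ-* (suc n) c f)) (eq (u n) c (sumℚ (suc n) f))
    where
    eq : ∀ a b c → a * (b * c) ≡ b * (a * c)
    eq = solve-∀ ℚ-ring

  mean-const : ∀ n c → mean (λ _ → c) n ≡ c
  mean-const n c = begin
    u n * sumℚ (suc n) (λ _ → c)   ≡⟨ cong (u n *_) (sumℚ-const (suc n) c) ⟩
    u n * (fromℕ (suc n) * c)      ≡⟨ eq (u n) (fromℕ (suc n)) c ⟩
    fromℕ (suc n) * u n * c        ≡⟨ cong (_* c) (fromℕ*u n) ⟩
    1ℚ * c                         ≡⟨ *-identityˡ c ⟩
    c                              ∎
    where
    open ≡-Reasoning
    eq : ∀ a b c → a * (b * c) ≡ b * a * c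
    eq = solve-∀ ℚ-ring

  ∣mean∣ : ∀ n f → ∣ mean f n ∣ ≤ mean (λ i → ∣ f i ∣) n
  ∣mean∣ n f = begin
    ∣ mean f n ∣                    ≡⟨ ∣p*q∣≡∣p∣*∣q∣ (u n) (sumℚ (suc n) f) ⟩
    ∣ u n ∣ * ∣ sumℚ (suc n) f ∣    ≡⟨ cong (_* ∣ sumℚ (suc n) f ∣) (0≤p⇒∣p∣≡p (0≤u n)) ⟩
    u n * ∣ sumℚ (suc n) f ∣        ≤⟨ *-monoˡ-≤-nonNeg (u n) {{nonNegative (0≤u n)}} (∣sumℚ∣ (suc n) f) ⟩
    mean (λ i → ∣ f i ∣) n          ∎
    where open ≤-Reasoning

  ∣mean-c∣ : ∀ n f c → ∣ mean f n - c ∣ ≤ mean (λ i → ∣ f i - c ∣) n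
  ∣mean-c∣ n f c = subst (λ t → ∣ t ∣ ≤ mean (λ i → ∣ f i - c ∣) n)
    (trans (mean-+ n f (λ _ → - c)) (cong (mean f n +_) (mean-const n (- c))))
    (∣mean∣ n (λ i → f i - c))

  mean-null : ∀ x → IsNull x → IsNull (mean x)
  -- The sum of n + 1 terms grows by `x (suc n)`, so the increments are the shifted sequence.
  mean-null x nx = cesàro (λ n → sumℚ (suc n) x) (λ n → x (suc n)) (λ n → refl) shifted
    where
    shifted : IsNull (λ n → x (suc n))
    shifted ε 0<ε with nx ε 0<ε
    ... | N , f = N , λ n N≤n → f (suc n) (ℕ.m≤n⇒m≤1+n N≤n)

  -- Distances are measured from the current term `x n`, since the limit need not be rational.
  deviation : (ℕ → ℚ) → ℕ → ℚ
  deviation x n = mean (λ i → ∣ x i - x n ∣) n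

  0≤deviation : ∀ x n → 0ℚ ≤ deviation x n
  0≤deviation x n = ≤-trans (0≤∣p∣ (mean (λ i → x i - x n) n)) (∣mean∣ n (λ i → x i - x n))

  -- ∣x i − x n∣ is at most ∣x i − x (i ⊔ N)∣, which vanishes for i ≥ N, plus ε / 2.
  deviation-null : ∀ x → IsCauchy x → IsNull (deviation x)
  deviation-null x cx ε 0<ε = N ℕ.⊔ proj₁ small , λ n le →
    close n (ℕ.m⊔n≤o⇒m≤o N (proj₁ small) le) (proj₂ small n (ℕ.m⊔n≤o⇒n≤o N (proj₁ small) le))
    where
    open ≤-Reasoning
    N : ℕ
    N = proj₁ (cx (½ * ε) (half-pos 0<ε))
    w : ℕ → ℚ
    w i = ∣ x i - x (i ℕ.⊔ N) ∣
    w-null : IsNull w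
    w-null δ 0<δ = N , λ n N≤n → subst (_< δ)
      (sym (trans (cong (λ t → ∣ ∣ x n - x t ∣ ∣) (ℕ.m≥n⇒m⊔n≡m N≤n)) (cong (λ t → ∣ ∣ t ∣ ∣) (+-inverseʳ (x n)))))
      0<δ
    small : ∃ λ M → ∀ n → M ℕ.≤ n → ∣ mean w n ∣ < ½ * ε
    small = mean-null w w-null (½ * ε) (half-pos 0<ε)
    close : ∀ n → N ℕ.≤ n → ∣ mean w n ∣ < ½ * ε → ∣ deviation x n ∣ < ε
    close n N≤n w<ε = begin-strict
      ∣ deviation x n ∣               ≡⟨ 0≤p⇒∣p∣≡p (0≤deviation x n) ⟩
      deviation x n                   ≤⟨ mean-mono n _ (λ i → w i + ½ * ε) (λ i _ → ≤-trans
                                           (triangle (x i) (x (i ℕ.⊔ N)) (x n))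
                                           (+-monoʳ-≤ (w i) (<⇒≤ (proj₂ (cx (½ * ε) (half-pos 0<ε))
                                             (i ℕ.⊔ N) n (ℕ.m≤n⊔m i N) N≤n)))) ⟩
      mean (λ i → w i + ½ * ε) n      ≡⟨ mean-+ n w (λ _ → ½ * ε) ⟩
      mean w n + mean (λ _ → ½ * ε) n ≡⟨ cong (mean w n +_) (mean-const n (½ * ε)) ⟩
      mean w n + ½ * ε                ≤⟨ +-monoˡ-≤ (½ * ε) (x≤∣x∣ (mean w n)) ⟩
      ∣ mean w n ∣ + ½ * ε            <⟨ +-monoˡ-< (½ * ε) w<ε ⟩
      ½ * ε + ½ * ε                   ≡⟨ ½+½ ε ⟩
      ε                               ∎

  mean-limit : ∀ x → IsCauchy x → IsNull (λ n → mean x n - x n)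
  mean-limit x cx = null-≤ _ (deviation x)
    (λ n → ≤-trans (∣mean-c∣ n x (x n)) (x≤∣x∣ (deviation x n))) (deviation-null x cx)

  -- Write x i · y (n - i) - x n · y n as (x i - x n) · y (n - i) + x n · (y (n - i) - y n). With
  -- both sequences bounded, the mean is controlled by the two deviations, the second one after
  -- reversing the order of summation.
  ⋆-limit : ∀ x y → IsCauchy x → IsCauchy y → IsNull (λ n → u n * (x ⋆ y) n - x n * y n)
  ⋆-limit x y cx cy with bounded x cx | bounded y cy
  ... | K , 0<K , x≤K | K′ , 0<K′ , y≤K′ =
    null-≤ _ (λ n → K′ * deviation x n + K * deviation y n) below
      (null-+ _ _ (null-scale K′ _ (deviation-null x cx)) (null-scale K _ (deviation-null y cy)))
    where
    open ≤-Reasoning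
    eq : ∀ a b c d → a * b - c * d ≡ (a - c) * b + c * (b - d)
    eq = solve-∀ ℚ-ring
    term : ∀ n i → ∣ x i * y (n ℕ.∸ i) - x n * y n ∣ ≤ K′ * ∣ x i - x n ∣ + K * ∣ y (n ℕ.∸ i) - y n ∣
    term n i = begin
      ∣ x i * y (n ℕ.∸ i) - x n * y n ∣
        ≡⟨ cong ∣_∣ (eq (x i) (y (n ℕ.∸ i)) (x n) (y n)) ⟩
      ∣ (x i - x n) * y (n ℕ.∸ i) + x n * (y (n ℕ.∸ i) - y n) ∣
        ≤⟨ ∣p+q∣≤∣p∣+∣q∣ ((x i - x n) * y (n ℕ.∸ i)) (x n * (y (n ℕ.∸ i) - y n)) ⟩
      ∣ (x i - x n) * y (n ℕ.∸ i) ∣ + ∣ x n * (y (n ℕ.∸ i) - y n) ∣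
        ≡⟨ cong₂ _+_ (trans (∣p*q∣≡∣p∣*∣q∣ (x i - x n) (y (n ℕ.∸ i))) (*-comm ∣ x i - x n ∣ ∣ y (n ℕ.∸ i) ∣))
                     (∣p*q∣≡∣p∣*∣q∣ (x n) (y (n ℕ.∸ i) - y n)) ⟩
      ∣ y (n ℕ.∸ i) ∣ * ∣ x i - x n ∣ + ∣ x n ∣ * ∣ y (n ℕ.∸ i) - y n ∣
        ≤⟨ +-mono-≤ (*-mono-≤ (0≤∣p∣ (y (n ℕ.∸ i))) (y≤K′ (n ℕ.∸ i)) (0≤∣p∣ (x i - x n)) ≤-refl)
                    (*-mono-≤ (0≤∣p∣ (x n)) (x≤K n) (0≤∣p∣ (y (n ℕ.∸ i) - y n)) ≤-refl) ⟩
      K′ * ∣ x i - x n ∣ + K * ∣ y (n ℕ.∸ i) - y n ∣ ∎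
    below : ∀ n → ∣ u n * (x ⋆ y) n - x n * y n ∣ ≤ ∣ K′ * deviation x n + K * deviation y n ∣
    below n = begin
      ∣ u n * (x ⋆ y) n - x n * y n ∣
        ≤⟨ ∣mean-c∣ n (λ i → x i * y (n ℕ.∸ i)) (x n * y n) ⟩
      mean (λ i → ∣ x i * y (n ℕ.∸ i) - x n * y n ∣) n
        ≤⟨ mean-mono n _ _ (λ i _ → term n i) ⟩
      mean (λ i → K′ * ∣ x i - x n ∣ + K * ∣ y (n ℕ.∸ i) - y n ∣) n
        ≡⟨ mean-+ n (λ i → K′ * ∣ x i - x n ∣) (λ i → K * ∣ y (n ℕ.∸ i) - y n ∣) ⟩
      mean (λ i → K′ * ∣ x i - x n ∣) n + mean (λ i → K * ∣ y (n ℕ.∸ i) - y n ∣) n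
        ≡⟨ cong₂ _+_ (mean-* n K′ (λ i → ∣ x i - x n ∣)) (mean-* n K (λ i → ∣ y (n ℕ.∸ i) - y n ∣)) ⟩
      K′ * deviation x n + K * mean (λ i → ∣ y (n ℕ.∸ i) - y n ∣) n
        ≡⟨ cong (λ t → K′ * deviation x n + K * (u n * t)) (sumℚ-reverse n (λ i → ∣ y i - y n ∣)) ⟩
      K′ * deviation x n + K * deviation y n
        ≤⟨ x≤∣x∣ (K′ * deviation x n + K * deviation y n) ⟩
      ∣ K′ * deviation x n + K * deviation y n ∣ ∎

  -- Evaluation of power series at x = −1

  -1^-+ : ∀ m n → -1^ (m ℕ.+ n) ≡ -1^ m * -1^ n
  -1^-+ zero    n = sym (*-identityˡ (-1^ n))
  -1^-+ (suc m) n = trans (cong -_ (-1^-+ m n)) (neg-distribˡ-* (-1^ m) (-1^ n))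

  signed : (ℕ → ℚ) → ℕ → ℚ
  signed a n = -1^ n * a n

  -- The substitution x ↦ -x is multiplicative.
  signed-⋆ : ∀ a b n → signed (a ⋆ b) n ≡ (signed a ⋆ signed b) n
  signed-⋆ a b n = trans (sym (sumℚ-* (suc n) (-1^ n) (λ i → a i * b (n ℕ.∸ i))))
    (sumℚ-cong-< (suc n) _ _ split)
    where
    eq : ∀ s t x y → s * t * (x * y) ≡ s * x * (t * y)
    eq = solve-∀ ℚ-ring
    split : ∀ i → i ℕ.< suc n → -1^ n * (a i * b (n ℕ.∸ i)) ≡ signed a i * signed b (n ℕ.∸ i)
    split i (s≤s i≤n) = trans
      (cong (_* (a i * b (n ℕ.∸ i))) (trans (cong -1^_ (sym (ℕ.m+[n∸m]≡n i≤n))) (-1^-+ i (n ℕ.∸ i))))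
      (eq (-1^ i) (-1^ (n ℕ.∸ i)) (a i) (b (n ℕ.∸ i)))

  sums : (ℕ → ℚ) → ℕ → ℚ
  sums a n = sumℚ (suc n) (signed a)

  infix 4 _↓_ _⇓_

  -- Stronger than convergence at -1: the partial sums are the very approximations of the real
  -- number, so they may be rewritten inside products.
  _↓_ : (ℕ → ℚ) → ℝ → Set
  a ↓ x = ∀ n → sums a n ≡ approx x n

  -- Cesàro summability, to which the Cauchy product of convergent series leads.
  record _⇓_ (a : ℕ → ℚ) (x : ℝ) : Set where
    constructor summable
    field
      limit : IsNull (λ n → mean (sums a) n - approx x n)

  sums-cong : ∀ a b → (∀ n → a n ≡ b n) → ∀ n → sums a n ≡ sums b n
  sums-cong a b a≡b n = sumℚ-cong (suc n) (signed a) (signed b) (λ i → cong (-1^ i *_) (a≡b i))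

  sums-* : ∀ c a n → sums (λ i → c * a i) n ≡ c * sums a n
  sums-* c a n = trans
    (sumℚ-cong (suc n) (signed (λ i → c * a i)) (λ i → c * signed a i) (λ i → swap (-1^ i) c (a i)))
    (sumℚ-* (suc n) c (signed a))
    where
    swap : ∀ x y z → x * (y * z) ≡ y * (x * z)
    swap = solve-∀ ℚ-ring

  sums-+ : ∀ a b n → sums (λ i → a i + b i) n ≡ sums a n + sums b n
  sums-+ a b n = trans
    (sumℚ-cong (suc n) (signed (λ i → a i + b i)) (λ i → signed a i + signed b i)
      (λ i → *-distribˡ-+ (-1^ i) (a i) (b i)))
    (sumℚ-+ (suc n) (signed a) (signed b))

  -- Regularity of Cesàro summation: a convergent series keeps its value.
  ↓⇒⇓ : ∀ {a x} → a ↓ x → a ⇓ x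
  ↓⇒⇓ {a} {x} a↓x = summable (null-cong
    (λ n → mean (sums a) n - approx x n) (λ n → mean (approx x) n - approx x n)
    (λ n → cong (_- approx x n) (mean-cong n (sums a) (approx x) a↓x))
    (mean-limit (approx x) (cauchy x)))

  ⇓-cong : ∀ {a b x} → (∀ n → a n ≡ b n) → a ⇓ x → b ⇓ x
  ⇓-cong {a} {b} {x} a≡b (summable p) = summable (null-cong
    (λ n → mean (sums b) n - approx x n) (λ n → mean (sums a) n - approx x n)
    (λ n → cong (_- approx x n) (sym (mean-cong n (sums a) (sums b) (sums-cong a b a≡b)))) p)

  ⇓-resp : ∀ {a x y} → x ≋ y → a ⇓ x → a ⇓ y
  ⇓-resp {a} {x} {y} (equal p) (summable q) = summable (null-cong
    (λ n → mean (sums a) n - approx y n)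
    (λ n → (mean (sums a) n - approx x n) + (approx x n - approx y n))
    (λ n → eq (mean (sums a) n) (approx x n) (approx y n))
    (null-+ (λ n → mean (sums a) n - approx x n) (λ n → approx x n - approx y n) q p))
    where
    eq : ∀ m x y → m - y ≡ (m - x) + (x - y)
    eq = solve-∀ ℚ-ring

  -- Both numbers are compared with the same means. This carries identities of formal series over to
  -- identities of real numbers.
  ⇓-unique : ∀ {a x y} → a ⇓ x → a ⇓ y → x ≋ y
  ⇓-unique {a} {x} {y} (summable p) (summable q) = equal (null-cong
    (λ n → approx x n - approx y n)
    (λ n → - 1ℚ * (mean (sums a) n - approx x n) + (mean (sums a) n - approx y n))
    (λ n → eq (mean (sums a) n) (approx x n) (approx y n))
    (null-+ (λ n → - 1ℚ * (mean (sums a) n - approx x n)) (λ n → mean (sums a) n - approx y n)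
      (null-scale (- 1ℚ) (λ n → mean (sums a) n - approx x n) p) q))
    where
    eq : ∀ m x y → x - y ≡ - 1ℚ * (m - x) + (m - y)
    eq = solve-∀ ℚ-ring

  ⇓-* : ∀ c {a x} → a ⇓ x → (λ n → c * a n) ⇓ fromℚ c *ᵣ x
  ⇓-* c {a} {x} (summable p) = summable (null-cong
    (λ n → mean (sums (λ i → c * a i)) n - c * approx x n) (λ n → c * (mean (sums a) n - approx x n))
    scaled (null-scale c (λ n → mean (sums a) n - approx x n) p))
    where
    eq : ∀ c m x → c * m - c * x ≡ c * (m - x)
    eq = solve-∀ ℚ-ring
    scaled : ∀ n → mean (sums (λ i → c * a i)) n - c * approx x n ≡ c * (mean (sums a) n - approx x n)
    scaled n = trans
      (cong (_- c * approx x n) (trans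
        (mean-cong n (sums (λ i → c * a i)) (λ i → c * sums a i) (sums-* c a))
        (mean-* n c (sums a))))
      (eq c (mean (sums a) n) (approx x n))

  ⇓-+ : ∀ {a b x y} → a ⇓ x → b ⇓ y → (λ n → a n + b n) ⇓ x +ᵣ y
  ⇓-+ {a} {b} {x} {y} (summable p) (summable q) = summable (null-cong
    (λ n → mean (sums (λ i → a i + b i)) n - (approx x n + approx y n))
    (λ n → (mean (sums a) n - approx x n) + (mean (sums b) n - approx y n))
    added (null-+ (λ n → mean (sums a) n - approx x n) (λ n → mean (sums b) n - approx y n) p q))
    where
    eq : ∀ m n x y → m + n - (x + y) ≡ (m - x) + (n - y)
    eq = solve-∀ ℚ-ring
    added : ∀ n → mean (sums (λ i → a i + b i)) n - (approx x n + approx y n)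
                  ≡ (mean (sums a) n - approx x n) + (mean (sums b) n - approx y n)
    added n = trans
      (cong (_- (approx x n + approx y n)) (trans
        (mean-cong n (sums (λ i → a i + b i)) (λ i → sums a i + sums b i) (sums-+ a b))
        (mean-+ n (sums a) (sums b))))
      (eq (mean (sums a) n) (mean (sums b) n) (approx x n) (approx y n))

  -- Cesàro's theorem on Cauchy products, valid without absolute convergence: by `partialSums²` the
  -- means are convolutions of partial sums, to which `⋆-limit` applies.
  ⇓-⋆ : ∀ {a b x y} → a ↓ x → b ↓ y → a ⋆ b ⇓ x *ᵣ y
  ⇓-⋆ {a} {b} {x} {y} a↓x b↓y = summable (null-cong
    (λ n → mean (sums (a ⋆ b)) n - approx x n * approx y n)
    (λ n → u n * (approx x ⋆ approx y) n - approx x n * approx y n)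
    (λ n → cong (λ t → u n * t - approx x n * approx y n) (product n))
    (⋆-limit (approx x) (approx y) (cauchy x) (cauchy y)))
    where
    open ≡-Reasoning
    product : ∀ n → sumℚ (suc n) (sums (a ⋆ b)) ≡ (approx x ⋆ approx y) n
    product n = begin
      sumℚ (suc n) (sums (a ⋆ b))
        ≡⟨ sumℚ-cong (suc n) (sums (a ⋆ b)) (λ i → sumℚ (suc i) (signed a ⋆ signed b))
             (λ i → sumℚ-cong (suc i) (signed (a ⋆ b)) (signed a ⋆ signed b) (signed-⋆ a b)) ⟩
      sumℚ (suc n) (λ i → sumℚ (suc i) (signed a ⋆ signed b))
        ≡⟨ partialSums² (signed a) (signed b) n ⟩
      (sums a ⋆ sums b) n
        ≡⟨ ⋆-congʳ (sums b) a↓x n ⟩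
      (approx x ⋆ sums b) n
        ≡⟨ ⋆-congˡ (approx x) b↓y n ⟩
      (approx x ⋆ approx y) n ∎

  ⇓-snoc : ∀ a b x f i → a ⇓ x +ᵣ sum₁ i f → b ⇓ f (suc i) →
           (λ n → a n + b n) ⇓ x +ᵣ sum₁ (suc i) f
  ⇓-snoc a b x f i a⇓ b⇓ =
    ⇓-resp {λ n → a n + b n} {x +ᵣ sum₁ i f +ᵣ f (suc i)} {x +ᵣ sum₁ (suc i) f}
      (pointwise (λ l → +-assoc (approx x l) (approx (sum₁ i f) l) (approx (f (suc i)) l)))
      (⇓-+ {a} {b} {x +ᵣ sum₁ i f} {f (suc i)} a⇓ b⇓)

  -- The logarithm of 2

  harmonic : ℕ → ℚ
  harmonic n = sumℚ n (λ j → -1^ j * u j)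

  -1^-even : ∀ n → -1^ (n ℕ.+ n) ≡ 1ℚ
  -1^-even zero    = refl
  -1^-even (suc n) = trans (cong (λ t → - -1^ t) (ℕ.+-suc n n))
    (trans (eq (-1^ (n ℕ.+ n))) (-1^-even n))
    where
    eq : ∀ x → - - x ≡ x
    eq = solve-∀ ℚ-ring

  u-double : ∀ n → u n ≡ u (suc (n ℕ.+ n)) + u (suc (n ℕ.+ n))
  u-double n = fromℕ*-cancel n (begin
    fromℕ (suc n) * u n                            ≡⟨ fromℕ*u n ⟩
    1ℚ                                             ≡⟨ fromℕ*u (suc (n ℕ.+ n)) ⟨
    fromℕ (suc (suc (n ℕ.+ n))) * x                ≡⟨ cong (λ t → fromℕ (suc t) * x) (ℕ.+-suc n n) ⟨
    fromℕ (suc n ℕ.+ suc n) * x                    ≡⟨ cong (_* x) (fromℕ-+ (suc n) (suc n)) ⟩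
    (fromℕ (suc n) + fromℕ (suc n)) * x            ≡⟨ eq (fromℕ (suc n)) x ⟩
    fromℕ (suc n) * (x + x)                        ∎)
    where
    open ≡-Reasoning
    x : ℚ
    x = u (suc (n ℕ.+ n))
    eq : ∀ a b → (a + a) * b ≡ a * (b + b)
    eq = solve-∀ ℚ-ring

  -- From n to n + 1 the right side loses 1/(n+1) and gains 1/(2n+1) + 1/(2n+2). As 1/(n+1) =
  -- 2/(2n+2), the net change is 1/(2n+1) - 1/(2n+2), as on the left.
  catalan : ∀ n → harmonic (n ℕ.+ n) ≡ sumℚ n (λ i → u (n ℕ.+ i))
  catalan zero    = refl
  catalan (suc n) = begin
    harmonic (suc n ℕ.+ suc n)
      ≡⟨ cong (λ t → harmonic (suc t)) (ℕ.+-suc n n) ⟩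
    harmonic (n ℕ.+ n) + s * u (n ℕ.+ n) + - s * x
      ≡⟨ cong₂ (λ h t → h + t * u (n ℕ.+ n) + - t * x) (catalan n) (-1^-even n) ⟩
    sumℚ n (λ i → u (n ℕ.+ i)) + 1ℚ * u (n ℕ.+ n) + - 1ℚ * x
      ≡⟨ eq (sumℚ n (λ i → u (n ℕ.+ i))) (u (n ℕ.+ n)) x ⟩
    sumℚ (suc n) (λ i → u (n ℕ.+ i)) - (x + x) + x
      ≡⟨ cong₂ (λ h t → h - t + x) (sumℚ-first n (λ i → u (n ℕ.+ i)))
           (trans (sym (u-double n)) (cong u (sym (ℕ.+-identityʳ n)))) ⟩
    u (n ℕ.+ 0) + sumℚ n (λ i → u (n ℕ.+ suc i)) - u (n ℕ.+ 0) + x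
      ≡⟨ eq′ (u (n ℕ.+ 0)) (sumℚ n (λ i → u (n ℕ.+ suc i))) x ⟩
    sumℚ n (λ i → u (n ℕ.+ suc i)) + x
      ≡⟨ cong (_+ x) (sumℚ-cong n _ _ (λ i → cong u (ℕ.+-suc n i))) ⟩
    sumℚ (suc n) (λ i → u (suc n ℕ.+ i)) ∎
    where
    open ≡-Reasoning
    s x : ℚ
    s = -1^ (n ℕ.+ n)
    x = u (suc (n ℕ.+ n))
    eq : ∀ h y x → h + 1ℚ * y + - 1ℚ * x ≡ h + y - (x + x) + x
    eq = solve-∀ ℚ-ring
    eq′ : ∀ a b x → a + b - a + x ≡ b + x
    eq′ = solve-∀ ℚ-ring

  riemannSum-recip : ∀ n → riemannSum recip 1ℚ (fromℕ 2) n ≡ sumℚ (suc n) (λ i → u (suc n ℕ.+ i))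
  riemannSum-recip n = sumℚ-cong (suc n) _ _ term
    where
    open ≡-Reasoning
    eq : ∀ r w f v → r * w * (f * v) ≡ r * (f * w) * v
    eq = solve-∀ ℚ-ring
    expand : ∀ a b w → (a + b) * w ≡ a * w + b * (1ℚ * w)
    expand = solve-∀ ℚ-ring
    -- The sample point is (n+i+2)/(n+1) and the width 1/(n+1), so the term is 1/(n+i+2). The factor
    -- `1ℚ` is the computed length 2 - 1 of the interval.
    term : ∀ i → recip (1ℚ + fromℕ (suc i) * (1ℚ * u n)) * (1ℚ * u n) ≡ u (suc n ℕ.+ i)
    term i = begin
      recip x * (1ℚ * u n)                           ≡⟨ cong (recip x *_) (*-identityˡ (u n)) ⟩
      recip x * u n                                  ≡⟨ *-identityʳ (recip x * u n) ⟨
      recip x * u n * 1ℚ                             ≡⟨ cong (recip x * u n *_) (fromℕ*u N) ⟨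
      recip x * u n * (fromℕ (suc N) * u N)          ≡⟨ eq (recip x) (u n) (fromℕ (suc N)) (u N) ⟩
      recip x * (fromℕ (suc N) * u n) * u N          ≡⟨ cong (λ t → recip x * t * u N) x≡ ⟩
      recip x * x * u N                              ≡⟨ cong (_* u N) (recip-inverse x 0<x) ⟩
      1ℚ * u N                                       ≡⟨ *-identityˡ (u N) ⟩
      u N                                            ∎
      where
      N : ℕ
      N = suc n ℕ.+ i
      x : ℚ
      x = 1ℚ + fromℕ (suc i) * (1ℚ * u n)
      x≡ : fromℕ (suc N) * u n ≡ x
      x≡ = begin
        fromℕ (suc N) * u n                               ≡⟨ cong (λ t → fromℕ t * u n) (ℕ.+-suc (suc n) i) ⟨
        fromℕ (suc n ℕ.+ suc i) * u n                     ≡⟨ cong (_* u n) (fromℕ-+ (suc n) (suc i)) ⟩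
        (fromℕ (suc n) + fromℕ (suc i)) * u n             ≡⟨ expand (fromℕ (suc n)) (fromℕ (suc i)) (u n) ⟩
        fromℕ (suc n) * u n + fromℕ (suc i) * (1ℚ * u n)  ≡⟨ cong (_+ fromℕ (suc i) * (1ℚ * u n)) (fromℕ*u n) ⟩
        x                                                 ∎
      0<x : 0ℚ < x
      0<x = subst (0ℚ <_) (+-comm (fromℕ (suc i) * (1ℚ * u n)) 1ℚ)
        (+-nonneg-pos (*-nonneg (0≤fromℕ (suc i)) (*-nonneg (<⇒≤ 0<1) (0≤u n))) 0<1)

  partialSum-1̄ : ∀ n → partialSum (bar 1 ∷ []) n ≡ - harmonic n
  partialSum-1̄ zero    = refl
  partialSum-1̄ (suc n) = trans
    (cong₂ (λ h t → h + - -1^ n * t * 1ℚ) (partialSum-1̄ n) (unitFraction¹ n))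
    (eq (harmonic n) (-1^ n) (u n))
    where
    eq : ∀ h s x → - h + - s * x * 1ℚ ≡ - (h + s * x)
    eq = solve-∀ ℚ-ring

  ln2 : ℝ
  ln2 = ln (fromℕ 2)

  -- The value of `P i` at -1, hence (-ln 2)ⁱ / i!; the case 0 is the constant series 1.
  ζ1̄ : ℕ → ℝ
  ζ1̄ zero    = fromℚ 1ℚ
  ζ1̄ (suc i) = ζ (bar 1 ∷ ones i)

  -- The Riemann sum with n + 1 intervals equals the alternating harmonic sum of 2n + 2 terms, so
  -- the two sides differ by terms of index 2n + 2 and n of one Cauchy sequence.
  ln2≋-ζ1̄ : ln2 ≋ -ᵣ ζ1̄ 1
  ln2≋-ζ1̄ = equal (null-cong _ _ difference
    (null-scale (- 1ℚ) _ (cauchy-subsequence (partialSum (bar 1 ∷ [])) (λ n → suc n ℕ.+ suc n)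
      (λ n → ℕ.m≤n⇒m≤n+o (suc n) (ℕ.n≤1+n n)) (partialSum-cauchy (bar 1 ∷ []) _))))
    where
    eq : ∀ h p → h - - p ≡ - 1ℚ * (- h - p)
    eq = solve-∀ ℚ-ring
    difference : ∀ n → approx ln2 n - - partialSum (bar 1 ∷ []) n
      ≡ - 1ℚ * (partialSum (bar 1 ∷ []) (suc n ℕ.+ suc n) - partialSum (bar 1 ∷ []) n)
    difference n = trans
      (cong (_- - p) (trans (riemannSum-recip n) (sym (catalan (suc n)))))
      (trans (eq (harmonic (suc n ℕ.+ suc n)) p)
        (cong (λ t → - 1ℚ * (t - p)) (sym (partialSum-1̄ (suc n ℕ.+ suc n)))))
      where
      p : ℚ
      p = partialSum (bar 1 ∷ []) n

  coeff-↓ : ∀ t s → .{{_ : ℕ.NonZero t}} → ∀ n → sums (coeff (plain t ∷ s)) n ≡ partialSum (bar t ∷ s) n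
  coeff-↓ t s n = trans
    (sumℚ-cong (suc n) (signed (coeff (plain t ∷ s))) (coeff (bar t ∷ s)) (coeff-bar t s))
    (sum-coeff (bar t ∷ s) n)

  P-↓ : ∀ i → P i ↓ ζ1̄ i
  P-↓ zero    n = trans (sumℚ-cong (suc n) (signed (coeff [])) (coeff []) unsigned) (sum-coeff [] n)
    where
    unsigned : ∀ n → signed (coeff []) n ≡ coeff [] n
    unsigned zero    = refl
    unsigned (suc n) = *-zeroʳ (-1^ suc n)
  P-↓ (suc i) n = coeff-↓ 1 (ones i) n

  -- The series identity for `P i ⋆ P 1`, whose binomial coefficient is i + 1, evaluated at -1 in
  -- two ways.
  ζ1̄-step : ∀ i → ζ1̄ i *ᵣ ζ1̄ 1 ≋ fromℚ (fromℕ (suc i)) *ᵣ ζ1̄ (suc i)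
  ζ1̄-step i = ⇓-unique {λ n → fromℕ (suc i) * P (suc i) n}
    (⇓-cong {P i ⋆ P 1} binomial (⇓-⋆ {P i} {P 1} {ζ1̄ i} {ζ1̄ 1} (P-↓ i) (P-↓ 1)))
    (⇓-* (fromℕ (suc i)) {P (suc i)} {ζ1̄ (suc i)} (↓⇒⇓ (P-↓ (suc i))))
    where
    binomial : ∀ n → (P i ⋆ P 1) n ≡ fromℕ (suc i) * P (suc i) n
    binomial n = trans (P-⋆-P i 1 (suc i) (ℕ.+-comm i 1) n)
      (cong (λ t → fromℕ t * P (suc i) n) (nC1≡n (suc i)))

  unit-*-unit : ∀ a b .{{_ : ℕ.NonZero a}} .{{_ : ℕ.NonZero b}} .{{_ : ℕ.NonZero (a ℕ.* b)}} →
                ℤ.+ 1 / (a ℕ.* b) ≡ (ℤ.+ 1 / a) * (ℤ.+ 1 / b)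
  unit-*-unit (suc a) (suc b) = fromℕ*-cancel (b ℕ.+ a ℕ.* suc b) (begin
    fromℕ (suc a ℕ.* suc b) * u (b ℕ.+ a ℕ.* suc b)     ≡⟨ fromℕ*u (b ℕ.+ a ℕ.* suc b) ⟩
    1ℚ * 1ℚ                                             ≡⟨ cong₂ _*_ (fromℕ*u a) (fromℕ*u b) ⟨
    fromℕ (suc a) * u a * (fromℕ (suc b) * u b)         ≡⟨ eq (fromℕ (suc a)) (u a) (fromℕ (suc b)) (u b) ⟩
    fromℕ (suc a) * fromℕ (suc b) * (u a * u b)         ≡⟨ cong (_* (u a * u b)) (fromℕ-* (suc a) (suc b)) ⟨
    fromℕ (suc a ℕ.* suc b) * (u a * u b)               ∎)
    where
    open ≡-Reasoning
    eq : ∀ a b c d → a * b * (c * d) ≡ a * c * (b * d)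
    eq = solve-∀ ℚ-ring

  -- Induction on i: the new factor ln 2 is -`ζ1̄ 1`, `ζ1̄-step` contracts the product and brings in
  -- i + 1, and the new factor 1/(i+1) of the factorial cancels it.
  ln2^/! : ∀ i → ln2 ^ᵣ i /! i ≋ fromℚ (-1^ i) *ᵣ ζ1̄ i
  ln2^/! zero    = pointwise (λ n → refl)
  ln2^/! (suc i) = begin
    ln2 ^ᵣ suc i /! suc i                                             ≈⟨ step₁ ⟩
    fromℚ (u i) *ᵣ ((ln2 ^ᵣ i /! i) *ᵣ ln2)                           ≈⟨ step₂ ⟩
    fromℚ (u i) *ᵣ ((fromℚ (-1^ i) *ᵣ ζ1̄ i) *ᵣ (-ᵣ ζ1̄ 1))             ≈⟨ step₃ ⟩
    fromℚ (- (-1^ i) * u i) *ᵣ (ζ1̄ i *ᵣ ζ1̄ 1)                         ≈⟨ step₄ ⟩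
    fromℚ (- (-1^ i) * u i) *ᵣ (fromℚ (fromℕ (suc i)) *ᵣ ζ1̄ (suc i))  ≈⟨ step₅ ⟩
    fromℚ (-1^ suc i) *ᵣ ζ1̄ (suc i)                                   ∎
    where
    open import Relation.Binary.Reasoning.Setoid ≋-setoid
    eq₁ : ∀ l p v w → l * p * (v * w) ≡ v * (p * w * l)
    eq₁ = solve-∀ ℚ-ring
    eq₂ : ∀ v s x y → v * (s * x * - y) ≡ - s * v * (x * y)
    eq₂ = solve-∀ ℚ-ring
    eq₃ : ∀ s v f x → s * v * (f * x) ≡ s * (f * v) * x
    eq₃ = solve-∀ ℚ-ring
    step₁ : ln2 ^ᵣ suc i /! suc i ≋ fromℚ (u i) *ᵣ ((ln2 ^ᵣ i /! i) *ᵣ ln2)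
    step₁ = pointwise (λ n → trans
      (cong (approx ln2 n * approx (ln2 ^ᵣ i) n *_) (unit-*-unit (suc i) (i !) {{_}} {{i ℕ.!≢0}} {{suc i ℕ.!≢0}}))
      (eq₁ (approx ln2 n) (approx (ln2 ^ᵣ i) n) (u i) ((ℤ.+ 1 / (i !)) {{i ℕ.!≢0}})))
    step₂ : fromℚ (u i) *ᵣ ((ln2 ^ᵣ i /! i) *ᵣ ln2)
            ≋ fromℚ (u i) *ᵣ ((fromℚ (-1^ i) *ᵣ ζ1̄ i) *ᵣ (-ᵣ ζ1̄ 1))
    step₂ = *ᵣ-cong {fromℚ (u i)} {fromℚ (u i)}
      {(ln2 ^ᵣ i /! i) *ᵣ ln2} {(fromℚ (-1^ i) *ᵣ ζ1̄ i) *ᵣ (-ᵣ ζ1̄ 1)} ≋-refl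
      (*ᵣ-cong {ln2 ^ᵣ i /! i} {fromℚ (-1^ i) *ᵣ ζ1̄ i} {ln2} { -ᵣ ζ1̄ 1} (ln2^/! i) ln2≋-ζ1̄)
    step₃ : fromℚ (u i) *ᵣ ((fromℚ (-1^ i) *ᵣ ζ1̄ i) *ᵣ (-ᵣ ζ1̄ 1))
            ≋ fromℚ (- (-1^ i) * u i) *ᵣ (ζ1̄ i *ᵣ ζ1̄ 1)
    step₃ = pointwise (λ n → eq₂ (u i) (-1^ i) (approx (ζ1̄ i) n) (approx (ζ1̄ 1) n))
    step₄ : fromℚ (- (-1^ i) * u i) *ᵣ (ζ1̄ i *ᵣ ζ1̄ 1)
            ≋ fromℚ (- (-1^ i) * u i) *ᵣ (fromℚ (fromℕ (suc i)) *ᵣ ζ1̄ (suc i))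
    step₄ = *ᵣ-cong {fromℚ (- (-1^ i) * u i)} {fromℚ (- (-1^ i) * u i)}
      {ζ1̄ i *ᵣ ζ1̄ 1} {fromℚ (fromℕ (suc i)) *ᵣ ζ1̄ (suc i)} ≋-refl (ζ1̄-step i)
    step₅ : fromℚ (- (-1^ i) * u i) *ᵣ (fromℚ (fromℕ (suc i)) *ᵣ ζ1̄ (suc i))
            ≋ fromℚ (-1^ suc i) *ᵣ ζ1̄ (suc i)
    step₅ = pointwise (λ n → trans
      (eq₃ (- (-1^ i)) (u i) (fromℕ (suc i)) (approx (ζ1̄ (suc i)) n))
      (cong (_* approx (ζ1̄ (suc i)) n)
        (trans (cong (- (-1^ i) *_) (fromℕ*u i)) (*-identityʳ (- (-1^ i))))))

  -- The recurrence

  -- The values at -1 are arbitrary real sequences here, known only through the summation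
  -- hypotheses; in the application `L i` is (ln 2)ⁱ / i! and `p i` is (-ln 2)ⁱ / i!.
  module Assembly (k : ℕ) (L p ζF ζG : ℕ → ℝ) where

    open Alternating k

    G : ℕ → ℕ → ℚ
    G n = coeff (plain 2 ∷ ones n)

    coefficient : ℕ → ℚ
    coefficient m = -1^ m * fromℕ ((m ℕ.+ suc k) C suc k)

    module _ (P-↓ : ∀ i → P i ↓ p i) (F-↓ : ∀ j → F j ↓ ζF j) (G-↓ : ∀ n → G n ↓ ζG n)
             (L≋p : ∀ i → L i ≋ fromℚ (-1^ i) *ᵣ p i) where

      alternatingSum-⇓ : ∀ n i →
        alternatingSum n i ⇓ ζF n +ᵣ (Σ[1≤ t ≤ i ] (fromℚ (-1^ t) *ᵣ (p t *ᵣ ζF (n ℕ.∸ t))))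
      alternatingSum-⇓ n zero    = ⇓-resp {F n} {ζF n}
        (pointwise (λ l → sym (+-identityʳ (approx (ζF n) l)))) (↓⇒⇓ (F-↓ n))
      alternatingSum-⇓ n (suc i) = ⇓-snoc
        (alternatingSum n i) (λ l → -1^ suc i * (P (suc i) ⋆ F (n ℕ.∸ suc i)) l)
        (ζF n) (λ t → fromℚ (-1^ t) *ᵣ (p t *ᵣ ζF (n ℕ.∸ t))) i
        (alternatingSum-⇓ n i)
        (⇓-* (-1^ suc i) {P (suc i) ⋆ F (n ℕ.∸ suc i)} {p (suc i) *ᵣ ζF (n ℕ.∸ suc i)}
          (⇓-⋆ {P (suc i)} {F (n ℕ.∸ suc i)} {p (suc i)} {ζF (n ℕ.∸ suc i)}
            (P-↓ (suc i)) (F-↓ (n ℕ.∸ suc i))))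

      -- The signs of the alternating sum are absorbed by the powers of -ln 2, so none are left in
      -- the final sum.
      unsign : ∀ i x → L i *ᵣ x ≋ fromℚ (-1^ i) *ᵣ (p i *ᵣ x)
      unsign i x = ≋-trans {L i *ᵣ x} {(fromℚ (-1^ i) *ᵣ p i) *ᵣ x} {fromℚ (-1^ i) *ᵣ (p i *ᵣ x)}
        (*ᵣ-cong {L i} {fromℚ (-1^ i) *ᵣ p i} {x} {x} (L≋p i) ≋-refl)
        (pointwise (λ n → *-assoc (-1^ i) (approx (p i) n) (approx x n)))

      -- Both sides are Cesàro sums at -1 of the two series equated by `shuffle`.
      generating : ∀ m →
        ζF (suc m) +ᵣ (Σ[1≤ i ≤ suc m ] (L i *ᵣ ζF (suc m ℕ.∸ i)))
        ≋ fromℚ (coefficient (suc m)) *ᵣ ζG (m ℕ.+ suc k)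
      generating m = ≋-trans
        {ζF (suc m) +ᵣ (Σ[1≤ i ≤ suc m ] (L i *ᵣ ζF (suc m ℕ.∸ i)))}
        {ζF (suc m) +ᵣ (Σ[1≤ i ≤ suc m ] (fromℚ (-1^ i) *ᵣ (p i *ᵣ ζF (suc m ℕ.∸ i))))}
        {fromℚ (coefficient (suc m)) *ᵣ ζG (m ℕ.+ suc k)}
        (+ᵣ-cong {ζF (suc m)} {ζF (suc m)}
          {Σ[1≤ i ≤ suc m ] (L i *ᵣ ζF (suc m ℕ.∸ i))}
          {Σ[1≤ i ≤ suc m ] (fromℚ (-1^ i) *ᵣ (p i *ᵣ ζF (suc m ℕ.∸ i)))}
          ≋-refl
          (sum₁-cong (suc m) {λ i → L i *ᵣ ζF (suc m ℕ.∸ i)}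
            {λ i → fromℚ (-1^ i) *ᵣ (p i *ᵣ ζF (suc m ℕ.∸ i))}
            (λ i _ → unsign i (ζF (suc m ℕ.∸ i)))))
        (⇓-unique {alternatingSum (suc m) (suc m)} (alternatingSum-⇓ (suc m) (suc m))
          (⇓-cong {λ l → coefficient (suc m) * G (m ℕ.+ suc k) l} (λ l → sym (shuffle m l))
            (⇓-* (coefficient (suc m)) {G (m ℕ.+ suc k)} {ζG (m ℕ.+ suc k)} (↓⇒⇓ (G-↓ (m ℕ.+ suc k))))))

      recurrence : ∀ m → ζF (suc m) ≋ fromℚ (coefficient (suc m)) *ᵣ ζG (m ℕ.+ suc k)
        -ᵣ L (suc m) *ᵣ ζF (suc m ℕ.∸ suc m) -ᵣ (Σ[1≤ i ≤ m ] (L i *ᵣ ζF (suc m ℕ.∸ i)))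
      recurrence m = rearrange (ζF (suc m)) (fromℚ (coefficient (suc m)) *ᵣ ζG (m ℕ.+ suc k))
        (λ i → L i *ᵣ ζF (suc m ℕ.∸ i)) m (generating m)

  module Limits (k : ℕ) where

    open Alternating k

    -- The bar falls on the first entry, which is the 2 exactly when no 1 precedes it; this is where
    -- the 2̄ accompanying (ln 2)ᵐ / m! comes from.
    ζF : ℕ → ℝ
    ζF zero    = ζ (bar 2 ∷ ones k)
    ζF (suc j) = ζ (bar 1 ∷ ones j ++ plain 2 ∷ ones k)

    F-↓ : ∀ j → F j ↓ ζF j
    F-↓ zero    = coeff-↓ 2 (ones k)
    F-↓ (suc j) = coeff-↓ 1 (ones j ++ plain 2 ∷ ones k)

    ζF-pos : ∀ j → 0 ℕ.< j → ∀ n →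
             approx (ζF j) n ≡ partialSum (bar 1 ∷ ones (j ℕ.∸ 1) ++ plain 2 ∷ ones k) n
    ζF-pos (suc j) _ n = refl

-- The recurrence for the alternating zeta values

open ShuffleAtMinusOne
open import Data.List.Base using (_∷_; _++_)
open import Data.Nat.Base using (ℕ; zero; suc; s≤s; NonZero; _+_; _∸_)
open import Data.Nat.Combinatorics using (_C_)
open import Data.Nat.Properties using (n∸n≡0; m<n⇒0<n∸m)
open import Data.Rational.Base using (ℚ; _*_; _-_)
open import Relation.Binary.PropositionalEquality using (sym; cong; cong₂)

theorem2p3 : ∀ (m k : ℕ) → .{{_ : NonZero m}} → .{{_ : NonZero k}} →
    ζ (bar 1 ∷ ones (m ∸ 1) ++ plain 2 ∷ ones (k ∸ 1))
    ≃ᵣ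
    fromℚ (-1^ m * fromℕ ((m + k) C k)) *ᵣ ζ (bar 2 ∷ ones (m + k ∸ 1))
    -ᵣ ln (fromℕ 2) ^ᵣ m /! m *ᵣ ζ (bar 2 ∷ ones (k ∸ 1))
    -ᵣ (Σ[1≤ i ≤ m ∸ 1 ] (ln (fromℕ 2) ^ᵣ i /! i *ᵣ ζ (bar 1 ∷ ones (m ∸ i ∸ 1) ++ plain 2 ∷ ones (k ∸ 1))))
theorem2p3 (suc m) (suc k) = null-cong
  (λ n → x n - (y n - z n * approx (ζF 0) n - approx (sum₁ m g) n))
  (λ n → x n - (y n - z n * approx (ζF (suc m ∸ suc m)) n - approx (sum₁ m f) n))
  (λ n → cong₂ (λ s t → x n - (y n - z n * s - t))
    (cong (λ j → approx (ζF j) n) (sym (n∸n≡0 m)))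
    -- For i ≤ m the index m + 1 - i is positive, so each summand has first entry 1̄ and one entry
    -- fewer in the following block of ones.
    (sum₁-pointwise m g f n (λ i i≤m → cong (approx (ln2 ^ᵣ i /! i) n *_)
      (sym (ζF-pos (suc m ∸ i) (m<n⇒0<n∸m (s≤s i≤m)) n)))))
  (equality (recurrence P-↓ F-↓ (λ n → coeff-↓ 2 (ones n)) ln2^/! m))
  where
  open Limits k
  open Assembly k (λ i → ln2 ^ᵣ i /! i) ζ1̄ ζF (λ n → ζ (bar 2 ∷ ones n)) using (coefficient; recurrence)
  x y z : ℕ → ℚ
  x n = approx (ζF (suc m)) n
  y n = coefficient (suc m) * approx (ζ (bar 2 ∷ ones (m + suc k))) n
  z n = approx (ln2 ^ᵣ suc m /! suc m) n
  f g : ℕ → ℝ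
  f i = ln2 ^ᵣ i /! i *ᵣ ζF (suc m ∸ i)
  g i = ln (fromℕ 2) ^ᵣ i /! i *ᵣ ζ (bar 1 ∷ ones (suc m ∸ i ∸ 1) ++ plain 2 ∷ ones (suc k ∸ 1))
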